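{- In the worst violated constraint model, there is an algorithm which, given oracle access to a hidden repetition-free 2SAT instance $\Phi$ on $n$ variables, generates a formula $\Phi'$ such that $\mathrm{SAT}(\Phi')=\mathrm{SAT}(\Phi)$, in time polynomial in $n$.
   Context: A SAT formula on Boolean variables $x_1,\dots,x_n$ is a conjunction of clauses $C_1,\dots,C_m$, each a disjunction of literals ($x_i$ or $\overline{x}_i$) on pairwise distinct variables; it is a 2SAT instance if each clause has at most $2$ literals. It is repetition-free if no two of its clauses are the same (i.e. no two clauses have the same set of literals). For a formula $\phi$, $\mathrm{SAT}(\phi)=\{\mathbf{x}\in\{0,1\}^n : \phi(\mathbf{x})=1\}$. Worst violated constraint model: the formula is hidden and is accessed only through an oracle. A query is a probabilistic assignment $\mathbf{a}:[n]\to[0,1]$, meaning that independently $\Pr[x_i=1]=\mathbf{a}(i)$ and $\Pr[\overline{x}_i=1]=1-\mathbf{a}(i)$. The violation probability of a clause $C_j$ with literal set $T(C_j)$ is $\Pr[C_j=0]=\prod_{\ell\in T(C_j)}\Pr[\ell=0]$. If all clauses have violation probability $0$, the oracle reports that the formula is satisfied; otherwise it returns the index $j$ of a clause with the highest violation probability, breaking ties arbitrarily (possibly adversarially). Running time is total running time, with each oracle query costing unit time. -}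

module Defs where

open import Data.Bool.Base using (Bool; true; if_then_else_; not)
open import Data.Fin.Base using (Fin; toℕ)
open import Data.Integer.Base using (+_)
open import Data.List.Base
  using (List; []; _∷_; _∷ʳ_; map; foldr; concatMap; any; all; length; lookup)
open import Data.List.Relation.Binary.BagAndSetEquality using (_∼[_]_; set)
open import Data.List.Relation.Unary.All using (All)
open import Data.List.Relation.Unary.AllPairs using (AllPairs)
open import Data.Nat.Base as ℕ using (ℕ; suc; NonZero; _≡ᵇ_)
open import Data.Product.Base using (Σ; _×_; _,_)
open import Data.Rational.Base as ℚ using (ℚ; 0ℚ; 1ℚ; _/_)
open import Data.Vec.Base as Vec using (Vec)
import Data.Vec.Properties as Vec
open import Level using (0ℓ)
open import Relation.Binary.PropositionalEquality
  using (_≡_; _≢_; refl; sym; trans; module ≡-Reasoning)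
open import Relation.Nullary using (¬_; contradiction)
open import Relation.Unary using (Pred)

data Literal (n : ℕ) : Set where
  pos neg : Fin n → Literal n

var : ∀ {n} → Literal n → Fin n
var (pos i) = i
var (neg i) = i

record Clause (n : ℕ) : Set where
  constructor clause
  field
    literals : List (Literal n)
    distinct : AllPairs (λ ℓ ℓ′ → var ℓ ≢ var ℓ′) literals

open Clause public

Formula : ℕ → Set
Formula n = List (Clause n)

Is2SAT : ∀ {n} → Formula n → Set
Is2SAT = All (λ C → length (literals C) ℕ.≤ 2)

RepetitionFree : ∀ {n} → Formula n → Set
RepetitionFree φ = ∀ i j → i ≢ j →
  ¬ (literals (lookup φ i) ∼[ set ] literals (lookup φ j))

Assignment : ℕ → Set
Assignment n = Fin n → Bool

evalLiteral : ∀ {n} → Assignment n → Literal n → Bool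
evalLiteral x (pos i) = x i
evalLiteral x (neg i) = not (x i)

evalClause : ∀ {n} → Assignment n → Clause n → Bool
evalClause x C = any (evalLiteral x) (literals C)

evalFormula : ∀ {n} → Assignment n → Formula n → Bool
evalFormula x φ = all (evalClause x) φ

SAT : ∀ {n} → Formula n → Pred (Assignment n) 0ℓ
SAT φ x = evalFormula x φ ≡ true

-- Algorithms only ever pose rational queries, so an oracle need not answer
-- any others.
record Probability : Set where
  constructor probability
  field
    value       : ℚ
    .nonneg     : 0ℚ ℚ.≤ value
    .atMostOne  : value ℚ.≤ 1ℚ

open Probability public

Query : ℕ → Set
Query n = Vec Probability n

probFalse : ∀ {n} → Query n → Literal n → ℚ
probFalse a (pos i) = 1ℚ ℚ.- value (Vec.lookup a i)
probFalse a (neg i) = value (Vec.lookup a i)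

violation : ∀ {n} → Query n → Clause n → ℚ
violation a C = foldr ℚ._*_ 1ℚ (map (probFalse a) (literals C))

data Response {n} (φ : Formula n) : Set where
  satisfied : Response φ
  violated  : Fin (length φ) → Response φ

data Admissible {n} (φ : Formula n) (a : Query n) : Response φ → Set where
  satisfied : (∀ i → violation a (lookup φ i) ≡ 0ℚ) →
              Admissible φ a satisfied
  violated  : ∀ j →
              ¬ (∀ i → violation a (lookup φ i) ≡ 0ℚ) →
              (∀ i → violation a (lookup φ i) ℚ.≤ violation a (lookup φ j)) →
              Admissible φ a (violated j)

-- Ties may be broken adaptively: the answer may depend on the list of
-- earlier queries, so asking the same query twice may give two answers.
record Oracle {n} (φ : Formula n) : Set where
  field
    answer     : List (Query n) → Query n → Response φ
    admissible : ∀ h a → Admissible φ a (answer h a)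

open Oracle public

-- Algorithms are structured programs for a random access machine with an
-- infinite memory of natural numbers, a write-only output and an oracle

Memory : Set
Memory = ℕ → ℕ

infixl 9 _[_↦_]

_[_↦_] : Memory → ℕ → ℕ → Memory
(M [ p ↦ v ]) q = if p ≡ᵇ q then v else M q

infixl 6 _⊕_ _⊖_

data Expr : Set where
  const   : ℕ → Expr
  deref   : Expr → Expr
  _⊕_ _⊖_ : Expr → Expr → Expr

⟦_⟧ : Expr → Memory → ℕ
⟦ const k ⟧ M = k
⟦ deref e ⟧ M = M (⟦ e ⟧ M)
⟦ d ⊕ e   ⟧ M = ⟦ d ⟧ M ℕ.+ ⟦ e ⟧ M
⟦ d ⊖ e   ⟧ M = ⟦ d ⟧ M ℕ.∸ ⟦ e ⟧ M

infix  5 _≔_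
infixr 4 _⨾_

data Program : Set where
  skip  : Program
  _≔_   : Expr → Expr → Program          -- the left side denotes an address
  _⨾_   : Program → Program → Program
  ifnz  : Expr → Program → Program → Program
  while : Expr → Program → Program       -- loops as long as the guard is nonzero
  emit  : Expr → Program
  query : (dest nums dens : Expr) → Program

record State (n : ℕ) : Set where
  constructor state
  field
    memory  : Memory
    output  : List ℕ
    history : List (Query n)

open State public

-- The number of variables is the only input; it is placed in cell 0.
initial : ∀ n → State n
initial n = state ((λ _ → 0) [ 0 ↦ n ]) [] []

-- The memory holds the query a as fractions: the numerator of a(i) is in
-- cell p + i and its denominator is in cell q + i.
Holds : ∀ {n} → Memory → (p q : ℕ) → Query n → Set
Holds M p q a = ∀ i → Σ (NonZero (M (q ℕ.+ toℕ i))) λ nz →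
  value (Vec.lookup a i) ≡ _/_ (+ M (p ℕ.+ toℕ i)) (M (q ℕ.+ toℕ i)) {{nz}}

code : ∀ {n} {φ : Formula n} → Response φ → ℕ
code satisfied    = 0
code (violated j) = suc (toℕ j)

-- O ⊢ P , σ ⇓ τ [ t ]: started in σ, the program P halts in τ after time t.
-- Every assignment, test, output and oracle query takes unit time.  A program
-- is fixed for all n, so its expressions have constant size.  Oracle answers
-- are O(n²), since a repetition-free 2SAT instance has O(n²) clauses, and the
-- only arithmetic is addition and truncated subtraction; hence the numbers
-- computed in time t have O(t + log n) bits, and polynomial time here is
-- polynomial time on a Turing machine.
infix 3 _⊢_,_⇓_[_]

data _⊢_,_⇓_[_] {n} {φ : Formula n} (O : Oracle φ) :
     Program → State n → State n → ℕ → Set where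

  skip : ∀ {σ} → O ⊢ skip , σ ⇓ σ [ 1 ]

  assign : ∀ {d e M out h} →
    O ⊢ d ≔ e , state M out h ⇓ state (M [ ⟦ d ⟧ M ↦ ⟦ e ⟧ M ]) out h [ 1 ]

  seq : ∀ {P Q ρ σ τ s t} →
    O ⊢ P , ρ ⇓ σ [ s ] →
    O ⊢ Q , σ ⇓ τ [ t ] →
    O ⊢ P ⨾ Q , ρ ⇓ τ [ s ℕ.+ t ]

  if-nonzero : ∀ {e P Q σ τ t} →
    ⟦ e ⟧ (memory σ) ≢ 0 →
    O ⊢ P , σ ⇓ τ [ t ] →
    O ⊢ ifnz e P Q , σ ⇓ τ [ suc t ]

  if-zero : ∀ {e P Q σ τ t} →
    ⟦ e ⟧ (memory σ) ≡ 0 →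
    O ⊢ Q , σ ⇓ τ [ t ] →
    O ⊢ ifnz e P Q , σ ⇓ τ [ suc t ]

  while-nonzero : ∀ {e P ρ σ τ s t} →
    ⟦ e ⟧ (memory ρ) ≢ 0 →
    O ⊢ P , ρ ⇓ σ [ s ] →
    O ⊢ while e P , σ ⇓ τ [ t ] →
    O ⊢ while e P , ρ ⇓ τ [ suc (s ℕ.+ t) ]

  while-zero : ∀ {e P σ} →
    ⟦ e ⟧ (memory σ) ≡ 0 →
    O ⊢ while e P , σ ⇓ σ [ 1 ]

  emit : ∀ {e M out h} →
    O ⊢ emit e , state M out h ⇓ state M (out ∷ʳ ⟦ e ⟧ M) h [ 1 ]

  query : ∀ {d p q M out h} a →
    Holds M (⟦ p ⟧ M) (⟦ q ⟧ M) a →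
    O ⊢ query d p q , state M out h
      ⇓ state (M [ ⟦ d ⟧ M ↦ code (answer O h a) ]) out (h ∷ʳ a) [ 1 ]

-- Against a fixed oracle a program has at most one run, so the existence of
-- a run with some property says that the run has that property.

value-injective : ∀ {p q} → value p ≡ value q → p ≡ q
value-injective refl = refl

Holds-unique : ∀ {n} M p q (a b : Query n) →
               Holds M p q a → Holds M p q b → a ≡ b
Holds-unique M p q a b Ha Hb = begin
  a                            ≡⟨ Vec.tabulate∘lookup a ⟨
  Vec.tabulate (Vec.lookup a)  ≡⟨ Vec.tabulate-cong same ⟩
  Vec.tabulate (Vec.lookup b)  ≡⟨ Vec.tabulate∘lookup b ⟩
  b                            ∎
  where
  open ≡-Reasoning
  same : ∀ i → Vec.lookup a i ≡ Vec.lookup b i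
  same i with Ha i | Hb i
  ... | _ , v | _ , w = value-injective (trans v (sym w))

deterministic : ∀ {n} {φ : Formula n} {O : Oracle φ} {P ρ σ τ s t} →
                O ⊢ P , ρ ⇓ σ [ s ] → O ⊢ P , ρ ⇓ τ [ t ] →
                σ ≡ τ × s ≡ t
deterministic skip skip = refl , refl
deterministic assign assign = refl , refl
deterministic (seq p q) (seq p′ q′) with deterministic p p′
... | refl , refl with deterministic q q′
... | refl , refl = refl , refl
deterministic (if-nonzero _ p) (if-nonzero _ p′) with deterministic p p′
... | refl , refl = refl , refl
deterministic (if-nonzero e≢0 _) (if-zero e≡0 _) = contradiction e≡0 e≢0
deterministic (if-zero e≡0 _) (if-nonzero e≢0 _) = contradiction e≡0 e≢0
deterministic (if-zero _ p) (if-zero _ p′) with deterministic p p′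
... | refl , refl = refl , refl
deterministic (while-nonzero _ p q) (while-nonzero _ p′ q′) with deterministic p p′
... | refl , refl with deterministic q q′
... | refl , refl = refl , refl
deterministic (while-nonzero e≢0 _ _) (while-zero e≡0) = contradiction e≡0 e≢0
deterministic (while-zero e≡0) (while-nonzero e≢0 _ _) = contradiction e≡0 e≢0
deterministic (while-zero _) (while-zero _) = refl , refl
deterministic emit emit = refl , refl
deterministic (query {p = p} {q} {M} a Ha) (query b Hb)
  with Holds-unique M (⟦ p ⟧ M) (⟦ q ⟧ M) a b Ha Hb
... | refl = refl , refl

-- Formulas as written to the output: a literal is its sign (1 positive,
-- 2 negative) followed by its variable, and 0 ends a clause.
encodeLiteral : ∀ {n} → Literal n → List ℕ
encodeLiteral (pos i) = 1 ∷ toℕ i ∷ []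
encodeLiteral (neg i) = 2 ∷ toℕ i ∷ []

encodeClause : ∀ {n} → Clause n → List ℕ
encodeClause C = concatMap encodeLiteral (literals C) ∷ʳ 0

encode : ∀ {n} → Formula n → List ℕ
encode = concatMap encodeClause

{-# OPTIONS --safe #-}
module Submission where

-- Fix a set T of at most two literals on distinct variables and query with the
-- literals of T certainly false and all other variables fair; let j be the
-- answer.  If T is a minimal clause of Φ, then j is that clause, and it stays
-- the unique worst one when any further literal ℓ is made true with probability
-- 7/8; making ℓ certainly true never satisfies Φ.  Conversely, these answers
-- for all ℓ force j ⊆ T: if j contained some ℓ outside T, a clause surviving
-- when ℓ is true would beat j when ℓ is false with probability 1/8.  So Φ
-- implies each T that passes, every minimal clause passes, and the T that pass
-- form a formula equivalent to Φ.

open import Defs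
import Data.Bool.Properties as Bool
open import Data.Bool.Base using (Bool; true; false; if_then_else_; T)
open import Data.Fin.Base using (Fin; zero; suc; toℕ; fromℕ<)
open import Data.Fin.Properties using (toℕ-injective; toℕ<n; toℕ-fromℕ<)
import Data.Fin.Properties as Fin
open import Data.Integer.Base as ℤ using (+_)
import Data.Integer.Properties as ℤ
open import Data.List.Base using (List; []; _∷_; _++_; _∷ʳ_; concatMap; length; lookup)
import Data.List.Properties as List
open import Data.List.Membership.Propositional using (_∈_; find; lose)
open import Data.List.Membership.Propositional.Properties using (∈-lookup; ∈-++⁺ʳ; ∈-++⁻)
open import Data.List.Relation.Unary.All as All using (All; []; _∷_)
open import Data.List.Relation.Unary.All.Properties using (++⁺; ++⁻ˡ; ++⁻ʳ)
open import Data.List.Relation.Unary.AllPairs using (AllPairs; []; _∷_)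
open import Data.List.Relation.Unary.Any as Any using (Any; here; there)
open import Data.List.Relation.Unary.Any.Properties using (lookup-index)
open import Data.Maybe.Base using (Maybe; just; nothing; maybe′)
open import Data.Maybe.Properties using (just-injective)
open import Data.Nat.Base as ℕ
  using (ℕ; zero; suc; _+_; _*_; _∸_; _^_; _⊔_; _≤_; _<_; z≤n; s≤s; _≡ᵇ_)
import Data.Nat.Properties as ℕ
open import Data.Product.Base using (∃-syntax; _×_; _,_; proj₂)
open import Data.Rational.Base as ℚ using (0ℚ; 1ℚ; _/_; toℚᵘ)
import Data.Rational.Properties as ℚ
open import Data.Rational.Unnormalised.Base as ℚᵘ using (mkℚᵘ; *≡*; *≤*)
import Data.Rational.Unnormalised.Properties as ℚᵘ
open import Data.Sum.Base using (_⊎_; inj₁; inj₂; [_,_]′)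
open import Data.Unit.Base using (⊤; tt)
open import Data.Vec.Base as Vec using (Vec; []; _∷_; _[_]≔_)
import Data.Vec.Properties as Vec
open import Function.Base using (_∘_; id)
open import Function.Bundles using (mk⇔)
open import Relation.Binary.PropositionalEquality
  using (_≡_; _≢_; refl; sym; trans; cong; cong₂; subst; module ≡-Reasoning)
open import Relation.Nullary using (yes; no; contradiction)
open import Relation.Unary using (_≐_)

-- A bare index says nothing about the clause behind it, so the only usable facts are that two
-- answers agree and that Φ is not satisfied. Passing therefore need not mean being a clause of Φ:
-- clauses inside T tie at violation probability 1, so a T with several of them may pass or fail as
-- the oracle pleases. Either outcome is harmless, because the minimal ones among them get their own
-- turn. Two copies of a minimal clause would tie in the same way, which is where freedom from
-- repetitions matters. Agreement is asked for at probability 7/8 and not at certainty: a certainly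
-- true ℓ has a certainly false complement, and a clause made of that complement and literals of T
-- could tie with T. The value 1/8 comes from a gap. A clause with ℓ is then violated with
-- probability at most 1/8, while a clause that survives a certainly true ℓ has at most two
-- literals, each false with probability at least 1/2 in the 7/8 query, hence is violated with
-- probability at least 1/4. Eighths turn every comparison into one between natural numbers over 64.

-- Fractions with a fixed denominator.

toℚᵘ-/ : ∀ z d → toℚᵘ (z / suc d) ℚᵘ.≃ mkℚᵘ z d
toℚᵘ-/ z d = ℚ.toℚᵘ-fromℚᵘ (mkℚᵘ z d)

/-mono-≤ : ∀ {a b} d → a ≤ b → + a / suc d ℚ.≤ + b / suc d
/-mono-≤ {a} {b} d a≤b = ℚ.toℚᵘ-cancel-≤
  (ℚᵘ.≤-respˡ-≃ (ℚᵘ.≃-sym (toℚᵘ-/ (+ a) d))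
  (ℚᵘ.≤-respʳ-≃ (ℚᵘ.≃-sym (toℚᵘ-/ (+ b) d))
  (*≤* (ℤ.*-monoʳ-≤-nonNeg (+ suc d) (ℤ.+≤+ a≤b)))))

/-cancel-≤ : ∀ {a b} d → + a / suc d ℚ.≤ + b / suc d → a ≤ b
/-cancel-≤ {a} {b} d p = ℤ.drop‿+≤+ (ℤ.*-cancelʳ-≤-pos (+ a) (+ b) (+ suc d)
  (ℚᵘ.drop-*≤* (ℚᵘ.≤-respˡ-≃ (toℚᵘ-/ (+ a) d)
               (ℚᵘ.≤-respʳ-≃ (toℚᵘ-/ (+ b) d) (ℚ.toℚᵘ-mono-≤ p)))))

0/d≡0 : ∀ d → + 0 / suc d ≡ 0ℚ
0/d≡0 d = ℚ.fromℚᵘ-cong {mkℚᵘ (+ 0) d} {mkℚᵘ (+ 0) 0} (*≡* refl)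

-- `_/_` cancels common factors, so with variable numerators neither side computes; the unnormalised
-- product does.
/-*-/ : ∀ a b → (+ a / 8) ℚ.* (+ b / 8) ≡ + (a * b) / 64
/-*-/ a b = ℚ.toℚᵘ-injective
  (ℚᵘ.≃-trans (ℚ.toℚᵘ-homo-* (+ a / 8) (+ b / 8))
  (ℚᵘ.≃-trans (ℚᵘ.*-cong (toℚᵘ-/ (+ a) 7) (toℚᵘ-/ (+ b) 7))
  (ℚᵘ.≃-trans (ℚᵘ.≃-reflexive (cong (λ z → mkℚᵘ z 63) (sym (ℤ.pos-* a b))))
  (ℚᵘ.≃-sym (toℚᵘ-/ (+ (a * b)) 63)))))

1-/ : ∀ {a} → a ≤ 8 → 1ℚ ℚ.- (+ a / 8) ≡ + (8 ∸ a) / 8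
1-/ z≤n = refl
1-/ (s≤s z≤n) = refl
1-/ (s≤s (s≤s z≤n)) = refl
1-/ (s≤s (s≤s (s≤s z≤n))) = refl
1-/ (s≤s (s≤s (s≤s (s≤s z≤n)))) = refl
1-/ (s≤s (s≤s (s≤s (s≤s (s≤s z≤n))))) = refl
1-/ (s≤s (s≤s (s≤s (s≤s (s≤s (s≤s z≤n)))))) = refl
1-/ (s≤s (s≤s (s≤s (s≤s (s≤s (s≤s (s≤s z≤n))))))) = refl
1-/ (s≤s (s≤s (s≤s (s≤s (s≤s (s≤s (s≤s (s≤s z≤n)))))))) = refl

-- Queries in eighths and integer weights of clauses.

eighths : (k : ℕ) → k ≤ 8 → Probability
eighths k k≤8 = probability (+ k / 8)
  (subst (ℚ._≤ + k / 8) (0/d≡0 7) (/-mono-≤ {0} {k} 7 z≤n)) (/-mono-≤ {k} {8} 7 k≤8)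

module _ {n : ℕ} where

  queryOf : (f : Fin n → ℕ) → (∀ i → f i ≤ 8) → Query n
  queryOf f f≤8 = Vec.tabulate (λ i → eighths (f i) (f≤8 i))

  value-queryOf : ∀ f (f≤8 : ∀ i → f i ≤ 8) i →
                  value (Vec.lookup (queryOf f f≤8) i) ≡ + f i / 8
  value-queryOf f f≤8 i =
    cong value (Vec.lookup∘tabulate (λ i → eighths (f i) (f≤8 i)) i)

  -- Eight times the probability that the literal is false.
  level : (Fin n → ℕ) → Literal n → ℕ
  level f (pos i) = 8 ∸ f i
  level f (neg i) = f i

  level≤8 : ∀ {f} → (∀ i → f i ≤ 8) → ∀ ℓ → level f ℓ ≤ 8
  level≤8 {f} f≤8 (pos i) = ℕ.m∸n≤m 8 (f i)
  level≤8     f≤8 (neg i) = f≤8 i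

  probFalse-queryOf : ∀ f (f≤8 : ∀ i → f i ≤ 8) ℓ →
                      probFalse (queryOf f f≤8) ℓ ≡ + level f ℓ / 8
  probFalse-queryOf f f≤8 (pos i) =
    trans (cong (λ p → 1ℚ ℚ.- p) (value-queryOf f f≤8 i)) (1-/ (f≤8 i))
  probFalse-queryOf f f≤8 (neg i) = value-queryOf f f≤8 i

  -- 64 times the violation probability of a clause with at most two literals.
  weight : (Literal n → ℕ) → List (Literal n) → ℕ
  weight g []           = 64
  weight g (ℓ ∷ [])     = g ℓ * 8
  weight g (ℓ ∷ ℓ′ ∷ _) = g ℓ * g ℓ′

  violation-queryOf : ∀ f (f≤8 : ∀ i → f i ≤ 8) (C : Clause n) →
    length (literals C) ≤ 2 →
    violation (queryOf f f≤8) C ≡ + weight (level f) (literals C) / 64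
  violation-queryOf f f≤8 (clause [] _) _ = refl
  violation-queryOf f f≤8 (clause (ℓ ∷ []) _) _ =
    trans (cong (ℚ._* 1ℚ) (probFalse-queryOf f f≤8 ℓ)) (/-*-/ (level f ℓ) 8)
  violation-queryOf f f≤8 (clause (ℓ ∷ ℓ′ ∷ []) _) _ =
    trans (cong₂ ℚ._*_ (probFalse-queryOf f f≤8 ℓ)
            (trans (ℚ.*-identityʳ _) (probFalse-queryOf f f≤8 ℓ′)))
          (/-*-/ (level f ℓ) (level f ℓ′))
  violation-queryOf f f≤8 (clause (_ ∷ _ ∷ _ ∷ _) _) (s≤s (s≤s ()))

  weight-full : ∀ {g L} → length L ≤ 2 → All (λ ℓ → g ℓ ≡ 8) L → weight g L ≡ 64
  weight-full _ [] = refl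
  weight-full _ (p ∷ []) = cong (_* 8) {y = 8} p
  weight-full _ (p ∷ q ∷ []) = cong₂ _*_ {y = 8} {v = 8} p q
  weight-full (s≤s (s≤s ())) (_ ∷ _ ∷ _ ∷ _)

  -- Factors bounded by 8 leave no slack in a product of 64.
  weight-full⁻¹ : ∀ {g} L → (∀ ℓ → g ℓ ≤ 8) → length L ≤ 2 → weight g L ≡ 64 →
                  All (λ ℓ → g ℓ ≡ 8) L
  weight-full⁻¹ [] _ _ _ = []
  weight-full⁻¹ {g} (ℓ ∷ []) _ _ eq = ℕ.*-cancelʳ-≡ (g ℓ) 8 8 eq ∷ []
  weight-full⁻¹ {g} (ℓ ∷ ℓ′ ∷ []) g≤8 _ eq =
    ℕ.≤-antisym (g≤8 ℓ) (ℕ.*-cancelʳ-≤ 8 (g ℓ) 8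
      (ℕ.≤-trans (ℕ.≤-reflexive (sym eq)) (ℕ.*-monoʳ-≤ (g ℓ) (g≤8 ℓ′)))) ∷
    ℕ.≤-antisym (g≤8 ℓ′) (ℕ.*-cancelˡ-≤ 8
      (ℕ.≤-trans (ℕ.≤-reflexive (sym eq)) (ℕ.*-monoˡ-≤ (g ℓ′) (g≤8 ℓ)))) ∷ []
  weight-full⁻¹ (_ ∷ _ ∷ _ ∷ _) _ (s≤s (s≤s ()))

  weight≤64 : ∀ {g} → (∀ ℓ → g ℓ ≤ 8) → ∀ L → weight g L ≤ 64
  weight≤64 g≤8 []           = ℕ.≤-refl
  weight≤64 g≤8 (ℓ ∷ [])     = ℕ.*-monoˡ-≤ 8 (g≤8 ℓ)
  weight≤64 g≤8 (ℓ ∷ ℓ′ ∷ _) = ℕ.*-mono-≤ (g≤8 ℓ) (g≤8 ℓ′)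

  weight-small : ∀ {g ℓ L} → (∀ ℓ → g ℓ ≤ 8) → length L ≤ 2 →
                 ℓ ∈ L → g ℓ ≡ 1 → weight g L ≤ 8
  weight-small {L = _ ∷ []} _ _ (here refl) eq rewrite eq = ℕ.≤-refl
  weight-small {g} {L = _ ∷ ℓ′ ∷ []} g≤8 _ (here refl) eq rewrite eq =
    ℕ.≤-trans (ℕ.≤-reflexive (ℕ.*-identityˡ (g ℓ′))) (g≤8 ℓ′)
  weight-small {g} {L = ℓ′ ∷ _ ∷ []} g≤8 _ (there (here refl)) eq rewrite eq =
    ℕ.≤-trans (ℕ.≤-reflexive (ℕ.*-identityʳ (g ℓ′))) (g≤8 ℓ′)
  weight-small {L = _ ∷ _ ∷ _ ∷ _} _ (s≤s (s≤s ()))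

  weight-nonzero : ∀ {g} L → length L ≤ 2 → weight g L ≢ 0 → All (λ ℓ → g ℓ ≢ 0) L
  weight-nonzero [] _ _ = []
  weight-nonzero (_ ∷ []) _ w≢0 = (λ eq → w≢0 (cong (_* 8) eq)) ∷ []
  weight-nonzero {g} (ℓ ∷ ℓ′ ∷ []) _ w≢0 =
    (λ eq → w≢0 (cong (_* g ℓ′) eq)) ∷
    (λ eq → w≢0 (trans (cong (g ℓ *_) eq) (ℕ.*-zeroʳ (g ℓ)))) ∷ []
  weight-nonzero (_ ∷ _ ∷ _ ∷ _) (s≤s (s≤s ()))

  -- The bound 4 · 4 = 16 has to exceed the 8 of `weight-small`; this strict gap refutes an unforced
  -- literal in the answered clause.
  weight-large : ∀ {g L} → length L ≤ 2 → All (λ ℓ → 4 ≤ g ℓ) L → 16 ≤ weight g L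
  weight-large _ [] = ℕ.m≤m+n 16 48
  weight-large _ (p ∷ []) = ℕ.≤-trans (ℕ.m≤m+n 16 16) (ℕ.*-monoˡ-≤ 8 p)
  weight-large _ (p ∷ q ∷ []) = ℕ.*-mono-≤ p q
  weight-large (s≤s (s≤s ())) (_ ∷ _ ∷ _ ∷ _)

  sign : Literal n → Bool
  sign (pos _) = true
  sign (neg _) = false

  lit : Bool → Fin n → Literal n
  lit true  = pos
  lit false = neg

-- The numerator that gives a literal of sign s false-probability k/8.
numeratorFor : Bool → ℕ → ℕ
numeratorFor true  k = 8 ∸ k
numeratorFor false k = k

numeratorFor≤8 : ∀ s {k} → k ≤ 8 → numeratorFor s k ≤ 8
numeratorFor≤8 true {k} _ = ℕ.m∸n≤m 8 k
numeratorFor≤8 false k≤8 = k≤8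

≡ᵇ-refl : ∀ m → (m ≡ᵇ m) ≡ true
≡ᵇ-refl zero    = refl
≡ᵇ-refl (suc m) = ≡ᵇ-refl m

-- Queries that force some literals to be false and bias one more.

module _ {n : ℕ} (h : Fin n → Maybe Bool) where

  -- h records which literals are forced to be false.
  Forced : Literal n → Set
  Forced ℓ = h (var ℓ) ≡ just (sign ℓ)

  -- Forced variables ignore `k`, `s` and `v`, so probes may run over all literals, those on forced
  -- variables included. With `k` equal to 4 either sign gives a fair coin, so the base query
  -- belongs to the same family.
  numerators : ℕ → Bool → ℕ → Fin n → ℕ
  numerators k s v i =
    maybe′ (λ s′ → numeratorFor s′ 8) (if v ≡ᵇ toℕ i then numeratorFor s k else 4) (h i)

  numerators≤8 : ∀ {k} → k ≤ 8 → ∀ s v i → numerators k s v i ≤ 8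
  numerators≤8 k≤8 s v i with h i
  ... | just s′ = numeratorFor≤8 s′ ℕ.≤-refl
  ... | nothing with v ≡ᵇ toℕ i
  ...   | true  = numeratorFor≤8 s k≤8
  ...   | false = ℕ.m≤m+n 4 4

  forced⇒level≡8 : ∀ k s v {ℓ} → Forced ℓ → level (numerators k s v) ℓ ≡ 8
  forced⇒level≡8 k s v {pos i} eq rewrite eq = refl
  forced⇒level≡8 k s v {neg i} eq rewrite eq = refl

  -- The value 0 for `k` is excluded: there the complement of the probed literal reaches level 8
  -- without being forced.
  level≡8⇒forced : ∀ {k} → k ≡ 1 ⊎ k ≡ 4 → ∀ s v {ℓ} →
                   level (numerators k s v) ℓ ≡ 8 → Forced ℓ
  level≡8⇒forced k∈ s v {pos i} eq with h i
  ... | just true = refl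
  ... | nothing with v ≡ᵇ toℕ i | s | k∈
  ...   | true  | true  | inj₁ refl = contradiction eq λ ()
  ...   | true  | true  | inj₂ refl = contradiction eq λ ()
  ...   | true  | false | inj₁ refl = contradiction eq λ ()
  ...   | true  | false | inj₂ refl = contradiction eq λ ()
  level≡8⇒forced k∈ s v {neg i} eq with h i
  ... | just false = refl
  ... | nothing with v ≡ᵇ toℕ i | s | k∈
  ...   | true  | true  | inj₁ refl = contradiction eq λ ()
  ...   | true  | true  | inj₂ refl = contradiction eq λ ()
  ...   | true  | false | inj₁ refl = contradiction eq λ ()
  ...   | true  | false | inj₂ refl = contradiction eq λ ()

  -- In the base query level 0 occurs exactly at complements of forced literals. A literal with
  -- nonzero level is thus forced or on a free variable, and in the latter case its own probe sets
  -- its level.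
  level≢0⇒ : ∀ s v s′ i → level (numerators 4 s v) (lit s′ i) ≢ 0 →
    Forced (lit s′ i) ⊎ level (numerators 1 s′ (toℕ i)) (lit s′ i) ≡ 1
  level≢0⇒ s v true i ≢0 with h i
  ... | just true  = inj₁ refl
  ... | just false = contradiction refl ≢0
  ... | nothing rewrite ≡ᵇ-refl (toℕ i) = inj₂ refl
  level≢0⇒ s v false i ≢0 with h i
  ... | just true  = contradiction refl ≢0
  ... | just false = inj₁ refl
  ... | nothing rewrite ≡ᵇ-refl (toℕ i) = inj₂ refl

  -- A certainly true probed literal has level 0, and so have the complements of forced literals.
  -- What remains has, in the 7/8 query, level 8 if forced, 7 if it is the complement of the probed
  -- literal, and 4 on a fair variable.
  level₀≢0⇒4≤level₁ : ∀ s v ℓ → level (numerators 0 s v) ℓ ≢ 0 →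
                       4 ≤ level (numerators 1 s v) ℓ
  level₀≢0⇒4≤level₁ s v (pos i) ≢0 with h i
  ... | just true  = ℕ.m≤m+n 4 4
  ... | just false = contradiction refl ≢0
  ... | nothing with v ≡ᵇ toℕ i | s
  ...   | true  | true  = contradiction refl ≢0
  ...   | true  | false = ℕ.m≤m+n 4 3
  ...   | false | _     = ℕ.≤-refl
  level₀≢0⇒4≤level₁ s v (neg i) ≢0 with h i
  ... | just false  = ℕ.m≤m+n 4 4
  ... | just true = contradiction refl ≢0
  ... | nothing with v ≡ᵇ toℕ i | s
  ...   | true  | false = contradiction refl ≢0
  ...   | true  | true  = ℕ.m≤m+n 4 3
  ...   | false | _     = ℕ.≤-refl

code-injective : ∀ {n} {φ : Formula n} {ρ ρ′ : Response φ} → code ρ ≡ code ρ′ → ρ ≡ ρ′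
code-injective {ρ = satisfied}  {satisfied}  _ = refl
code-injective {ρ = violated _} {violated _} eq =
  cong violated (toℕ-injective (ℕ.suc-injective eq))

-- Satisfaction witnessed by true literals.

Satisfies : ∀ {n} → Assignment n → Clause n → Set
Satisfies x C = Any (λ ℓ → evalLiteral x ℓ ≡ true) (literals C)

Models : ∀ {n} → Assignment n → Formula n → Set
Models x = All (Satisfies x)

module _ {n} (x : Assignment n) where

  evalClause⇒Satisfies : ∀ L d → evalClause x (clause L d) ≡ true →
                         Satisfies x (clause L d)
  evalClause⇒Satisfies (ℓ ∷ L) (_ ∷ d) eq with evalLiteral x ℓ in e
  ... | true  = here e
  ... | false = there (evalClause⇒Satisfies L d eq)

  Satisfies⇒evalClause : ∀ L d → Satisfies x (clause L d) →
                         evalClause x (clause L d) ≡ true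
  Satisfies⇒evalClause (ℓ ∷ L) _       (here e) rewrite e = refl
  Satisfies⇒evalClause (ℓ ∷ L) (_ ∷ d) (there p) with evalLiteral x ℓ
  ... | true  = refl
  ... | false = Satisfies⇒evalClause L d p

  SAT⇒Models : ∀ φ → SAT φ x → Models x φ
  SAT⇒Models []      _ = []
  SAT⇒Models (C ∷ φ) eq with evalClause x C in e
  ... | true = evalClause⇒Satisfies (literals C) (distinct C) e ∷ SAT⇒Models φ eq

  Models⇒SAT : ∀ φ → Models x φ → SAT φ x
  Models⇒SAT []      _ = refl
  Models⇒SAT (C ∷ φ) (p ∷ ps) rewrite Satisfies⇒evalClause (literals C) (distinct C) p =
    Models⇒SAT φ ps

-- What worst clauses reveal about a set of forced literals.

module _ {n} {Φ : Formula n} (Φ-2SAT : Is2SAT Φ) where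

  lits : Fin (length Φ) → List (Literal n)
  lits i = literals (lookup Φ i)

  lits≤2 : ∀ i → length (lits i) ≤ 2
  lits≤2 i = All.lookup Φ-2SAT (∈-lookup i)

  private
    W : (Fin n → ℕ) → Fin (length Φ) → ℕ
    W f i = weight (level f) (lits i)

  -- Admissibility in integer weights. As clause `j` has the largest weight, "not all are zero"
  -- reduces to its own weight being nonzero.
  Maximal : (Fin n → ℕ) → Response Φ → Set
  Maximal f satisfied    = ∀ i → W f i ≡ 0
  Maximal f (violated j) = W f j ≢ 0 × (∀ i → W f i ≤ W f j)

  admissible⇒maximal : ∀ f (f≤8 : ∀ i → f i ≤ 8) {ρ} →
                       Admissible Φ (queryOf f f≤8) ρ → Maximal f ρ
  admissible⇒maximal f f≤8 = go
    where
    violation-W : ∀ i → violation (queryOf f f≤8) (lookup Φ i) ≡ + W f i / 64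
    violation-W i = violation-queryOf f f≤8 (lookup Φ i) (lits≤2 i)

    W≡0 : ∀ i → violation (queryOf f f≤8) (lookup Φ i) ≡ 0ℚ → W f i ≡ 0
    W≡0 i eq = ℕ.n≤0⇒n≡0 (/-cancel-≤ {W f i} {0} 63
      (ℚ.≤-reflexive (trans (sym (violation-W i)) (trans eq (sym (0/d≡0 63))))))

    go : ∀ {ρ} → Admissible Φ (queryOf f f≤8) ρ → Maximal f ρ
    go (satisfied all≡0) i = W≡0 i (all≡0 i)
    go (violated j ¬all≡0 max) = Wj≢0 , W≤Wj
      where
      W≤Wj : ∀ i → W f i ≤ W f j
      W≤Wj i = /-cancel-≤ {W f i} {W f j} 63
        (ℚ.≤-trans (ℚ.≤-reflexive (sym (violation-W i)))
        (ℚ.≤-trans (max i) (ℚ.≤-reflexive (violation-W j))))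
      Wj≢0 : W f j ≢ 0
      Wj≢0 Wj≡0 = ¬all≡0 λ i → trans (violation-W i)
        (trans (cong (λ w → + w / 64)
                     (ℕ.n≤0⇒n≡0 (ℕ.≤-trans (W≤Wj i) (ℕ.≤-reflexive Wj≡0))))
               (0/d≡0 63))

  module _ (h : Fin n → Maybe Bool) where

    -- If clause j had an unforced literal of sign s on i, making that literal
    -- almost certainly true would push j below every clause that survives
    -- making it certainly true.
    answers⇒forced : ∀ s₀ v₀ s i {j ρ} →
      Maximal (numerators h 4 s₀ v₀) (violated j) →
      Maximal (numerators h 1 s (toℕ i)) (violated j) →
      Maximal (numerators h 0 s (toℕ i)) ρ → code ρ ≢ 0 →
      lit s i ∈ lits j → Forced h (lit s i)
    answers⇒forced _ _ s i {ρ = satisfied} _ _ _ ρ≢0 _ = contradiction refl ρ≢0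
    answers⇒forced s₀ v₀ s i {j} {violated k} (Wj≢0 , _) (_ , W≤Wj) (Wk≢0 , _) _ ℓ∈j
      with level≢0⇒ h s₀ v₀ s i (All.lookup (weight-nonzero (lits j) (lits≤2 j) Wj≢0) ℓ∈j)
    ... | inj₁ forced = forced
    ... | inj₂ level≡1 = contradiction
      (ℕ.≤-trans (weight-large (lits≤2 k)
                   (All.map (λ {ℓ} → level₀≢0⇒4≤level₁ h s (toℕ i) ℓ)
                            (weight-nonzero (lits k) (lits≤2 k) Wk≢0)))
      (ℕ.≤-trans (W≤Wj k)
                 (weight-small (level≤8 (numerators≤8 h (ℕ.m≤m+n 1 7) s (toℕ i)))
                               (lits≤2 j) ℓ∈j level≡1)))
      (ℕ.<⇒≱ (ℕ.m≤m+n 9 7))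

    -- Uniqueness concerns the index: it forbids a second copy as well as any other clause inside
    -- the forced literals, since either would let tie-breaking change the answer.
    Minimal : Fin (length Φ) → Set
    Minimal i = All (Forced h) (lits i) × (∀ k → All (Forced h) (lits k) → k ≡ i)

    minimal⇒W≡64 : ∀ {i} k s v → Minimal i → W (numerators h k s v) i ≡ 64
    minimal⇒W≡64 {i} k s v (forced , _) =
      weight-full (lits≤2 i) (All.map (forced⇒level≡8 h k s v) forced)

    -- No restriction on `k` is made: forced values override the probed literal, so clause `i` keeps
    -- weight 64 even when `k` is 0.
    minimal⇒unsatisfied : ∀ {i ρ} k s v → Minimal i → Maximal (numerators h k s v) ρ →
                          code ρ ≢ 0
    minimal⇒unsatisfied {i} {satisfied} k s v minimal W≡0 _ =
      contradiction (trans (sym (minimal⇒W≡64 k s v minimal)) (W≡0 i)) λ ()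

    -- Weight 64 is the maximum, and for these `k` only clauses inside the forced literals attain
    -- it, so there is no tie to break.
    minimal⇒violated : ∀ {i k ρ} → k ≡ 1 ⊎ k ≡ 4 → ∀ s v → Minimal i →
                       Maximal (numerators h k s v) ρ → ρ ≡ violated i
    minimal⇒violated {ρ = satisfied} _ s v minimal max =
      contradiction refl (minimal⇒unsatisfied _ s v minimal max)
    minimal⇒violated {i} {k} {violated j} k∈ s v minimal (_ , W≤Wj) = cong violated
      (proj₂ minimal j (All.map (level≡8⇒forced h k∈ s v)
        (weight-full⁻¹ (lits j) g≤8 (lits≤2 j) (ℕ.≤-antisym W≤64 64≤W))))
      where
      k≤8 : k ≤ 8
      k≤8 = [ (λ { refl → ℕ.m≤m+n 1 7 }) , (λ { refl → ℕ.m≤m+n 4 4 }) ]′ k∈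
      g≤8 : ∀ ℓ → level (numerators h k s v) ℓ ≤ 8
      g≤8 = level≤8 (numerators≤8 h k≤8 s v)
      W≤64 : W (numerators h k s v) j ≤ 64
      W≤64 = weight≤64 g≤8 (lits j)
      64≤W : 64 ≤ W (numerators h k s v) j
      64≤W = ℕ.≤-trans (ℕ.≤-reflexive (sym (minimal⇒W≡64 k s v minimal))) (W≤Wj i)

-- Polynomial time bounds read off from the syntax.

-- N bounds the number of iterations of every loop.
cost : ℕ → Program → ℕ
cost N skip          = 1
cost N (_ ≔ _)       = 1
cost N (P ⨾ Q)       = cost N P + cost N Q
cost N (ifnz _ P Q)  = suc (cost N P + cost N Q)
cost N (while _ P)   = suc (N * suc (cost N P))
cost N (emit _)      = 1
cost N (query _ _ _) = 1

depth : Program → ℕ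
depth (P ⨾ Q)      = depth P ⊔ depth Q
depth (ifnz _ P Q) = depth P ⊔ depth Q
depth (while _ P)  = suc (depth P)
depth _            = 0

-- Of the two extra units for a loop, one pays for its last test and the other, multiplied by the
-- number of iterations, for the tests before each pass.
size : Program → ℕ
size (P ⨾ Q)      = size P + size Q
size (ifnz _ P Q) = suc (size P + size Q)
size (while _ P)  = 2 + size P
size _            = 1

module _ (n : ℕ) where

  private
    N = suc n

    1≤N^ : ∀ k → 1 ≤ N ^ k
    1≤N^ k = ℕ.m^n>0 N k

    raise : ∀ c {k k′} → k ≤ k′ → c * N ^ k ≤ c * N ^ k′
    raise c k≤k′ = ℕ.*-monoʳ-≤ c (ℕ.^-monoʳ-≤ N k≤k′)

    sum-bound : ∀ {x y} c d k l → x ≤ c * N ^ k → y ≤ d * N ^ l →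
                x + y ≤ (c + d) * N ^ (k ⊔ l)
    sum-bound {x} {y} c d k l x≤ y≤ = begin
      x + y                                  ≤⟨ ℕ.+-mono-≤ x≤ y≤ ⟩
      c * N ^ k + d * N ^ l
        ≤⟨ ℕ.+-mono-≤ (raise c (ℕ.m≤m⊔n k l)) (raise d (ℕ.m≤n⊔m k l)) ⟩
      c * N ^ (k ⊔ l) + d * N ^ (k ⊔ l)      ≡⟨ ℕ.*-distribʳ-+ (N ^ (k ⊔ l)) c d ⟨
      (c + d) * N ^ (k ⊔ l)                  ∎
      where open ℕ.≤-Reasoning

  cost≤ : ∀ P → cost N P ≤ size P * N ^ depth P
  cost≤ skip          = ℕ.≤-refl
  cost≤ (_ ≔ _)       = ℕ.≤-refl
  cost≤ (P ⨾ Q)       = sum-bound (size P) (size Q) (depth P) (depth Q) (cost≤ P) (cost≤ Q)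
  cost≤ (ifnz _ P Q)  = ℕ.+-mono-≤ (1≤N^ (depth P ⊔ depth Q))
    (sum-bound (size P) (size Q) (depth P) (depth Q) (cost≤ P) (cost≤ Q))
  cost≤ (while _ P)   = ℕ.+-mono-≤ (1≤N^ (suc d)) (begin
    N * suc (cost N P)             ≤⟨ ℕ.*-monoʳ-≤ N (ℕ.+-mono-≤ (1≤N^ d) (cost≤ P)) ⟩
    N * (suc (size P) * N ^ d)     ≡⟨ ℕ.*-assoc N (suc (size P)) (N ^ d) ⟨
    N * suc (size P) * N ^ d       ≡⟨ cong (_* N ^ d) (ℕ.*-comm N (suc (size P))) ⟩
    suc (size P) * N * N ^ d       ≡⟨ ℕ.*-assoc (suc (size P)) N (N ^ d) ⟩
    suc (size P) * N ^ suc d       ∎)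
    where
    open ℕ.≤-Reasoning
    d = depth P
  cost≤ (emit _)      = ℕ.≤-refl
  cost≤ (query _ _ _) = ℕ.≤-refl

-- The learning program.

-- Cell 0 holds n, cells 1 to 6 hold the scalars below, cell 7 + i the
-- denominator and cell 7 + n + i the numerator of the probability of variable
-- i.  The cell 7 + n + n is free, so that n may serve as a dummy variable.

Cell : Set
Cell = Fin 6

V₁ V₂ V₃ R J OK : Cell
V₁ = zero
V₂ = suc zero
V₃ = suc (suc zero)
R  = suc (suc (suc zero))
J  = suc (suc (suc (suc zero)))
OK = suc (suc (suc (suc (suc zero))))

address : Cell → Expr
address c = const (suc (toℕ c))

cell : Cell → Expr
cell c = deref (address c)

inputSize : Expr
inputSize = deref (const 0)

numerator : Cell → Expr
numerator c = const 7 ⊕ (inputSize ⊕ cell c)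

distance : Cell → Cell → Expr
distance c d = (cell c ⊖ cell d) ⊕ (cell d ⊖ cell c)

-- The counter is decremented before the body, which therefore sees the bound minus 1 down to 0. A
-- bound of n + 1 includes the dummy variable n.
for : Cell → Expr → Program → Program
for c e P = address c ≔ e ⨾ while (cell c) (address c ≔ cell c ⊖ const 1 ⨾ P)

-- The forced numerators are written after the probed one and so override it. Restoring three cells
-- afterwards keeps the cost of a probe independent of n.
probe : ℕ → (s₁ s₂ s₃ : Bool) → Program
probe k s₁ s₂ s₃ =
  numerator V₃ ≔ const (numeratorFor s₃ k) ⨾
  numerator V₁ ≔ const (numeratorFor s₁ 8) ⨾
  numerator V₂ ≔ const (numeratorFor s₂ 8) ⨾
  query (address R) (const 7 ⊕ inputSize) (const 7) ⨾
  numerator V₃ ≔ const 4 ⨾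
  numerator V₁ ≔ const 4 ⨾
  numerator V₂ ≔ const 4

guard : Expr → Program
guard e = ifnz e skip (address OK ≔ const 0)

check : (s₁ s₂ s₃ : Bool) → Program
check s₁ s₂ s₃ =
  probe 1 s₁ s₂ s₃ ⨾
  -- Truncated subtraction makes this nonzero exactly when the two answers coincide.
  guard (const 1 ⊖ distance R J) ⨾
  probe 0 s₁ s₂ s₃ ⨾
  guard (cell R)

test : (s₁ s₂ : Bool) → Program
test s₁ s₂ =
  probe 4 s₁ s₂ true ⨾
  address J ≔ cell R ⨾
  -- As a flag this is up exactly when the base answer names a clause.
  address OK ≔ cell R ⨾
  for V₃ inputSize (check s₁ s₂ true ⨾ check s₁ s₂ false)

emitLiteral : Bool → Cell → Program
emitLiteral s c =
  ifnz (inputSize ⊖ cell c) (emit (const (if s then 1 else 2)) ⨾ emit (cell c)) skip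

emitClause : (s₁ s₂ : Bool) → Program
emitClause s₁ s₂ =
  ifnz (distance V₁ V₂) (emitLiteral s₁ V₁) skip ⨾
  emitLiteral s₂ V₂ ⨾
  emit (const 0)

attempt : (s₁ s₂ : Bool) → Program
attempt s₁ s₂ = test s₁ s₂ ⨾ ifnz (cell OK) (emitClause s₁ s₂) skip

attempts : Program
attempts =
  attempt true true ⨾ attempt true false ⨾ attempt false true ⨾ attempt false false

initialise : Program
initialise = for V₁ (inputSize ⊕ const 1)
  -- For positive n, the pass for the dummy n puts its denominator into cell 7 + n, which is the
  -- numerator of variable 0; the last pass repairs it.
  (const 7 ⊕ cell V₁ ≔ const 8 ⨾ numerator V₁ ≔ const 4)

learn : Program
learn = initialise ⨾
  for V₁ (inputSize ⊕ const 1)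
    (for V₂ (inputSize ⊕ const 1) attempts)

-- Memory updates and the invariant of the machine state.

≡ᵇ-cancelˡ : ∀ k m p → (k + m ≡ᵇ k + p) ≡ (m ≡ᵇ p)
≡ᵇ-cancelˡ zero    m p = refl
≡ᵇ-cancelˡ (suc k) m p = ≡ᵇ-cancelˡ k m p

≡ᵇ-true : ∀ {m p} → (m ≡ᵇ p) ≡ true → m ≡ p
≡ᵇ-true {m} {p} eq = ℕ.≡ᵇ⇒≡ m p (subst T (sym eq) tt)

≡ᵇ-false : ∀ {m p} → (m ≡ᵇ p) ≡ false → m ≢ p
≡ᵇ-false {m} eq refl with () ← trans (sym eq) (≡ᵇ-refl m)

≢⇒≡ᵇ-false : ∀ {m p} → m ≢ p → (m ≡ᵇ p) ≡ false
≢⇒≡ᵇ-false {m} {p} m≢p with m ≡ᵇ p in eq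
... | true  = contradiction (≡ᵇ-true {m} {p} eq) m≢p
... | false = refl

↦-same : ∀ M {p v q} → p ≡ q → (M [ p ↦ v ]) q ≡ v
↦-same M {p} refl rewrite ≡ᵇ-refl p = refl

↦-other : ∀ M {p v q} → p ≢ q → (M [ p ↦ v ]) q ≡ M q
↦-other M {p} {q = q} p≢q rewrite ≢⇒≡ᵇ-false {p} {q} p≢q = refl

_[_↦_]ᶠ : ∀ {n} → (Fin n → ℕ) → ℕ → ℕ → Fin n → ℕ
(f [ v ↦ a ]ᶠ) i = if v ≡ᵇ toℕ i then a else f i

half : ∀ {n} → Fin n → ℕ
half _ = 4

-- If v₁ ≡ v₂ the second literal prevails, because probe writes it last.
forced : ∀ {n} → Bool → ℕ → Bool → ℕ → Fin n → Maybe Bool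
forced s₁ v₁ s₂ v₂ i =
  if v₂ ≡ᵇ toℕ i then just s₂ else if v₁ ≡ᵇ toℕ i then just s₁ else nothing

-- Variables below `m` are left unconstrained because `initialise` works downwards; afterwards `m`
-- is 0. The history is not tracked, since answers are admissible after any history.
record At {n} (m : ℕ) (s : Vec ℕ 6) (f : Fin n → ℕ) (out : List ℕ) (σ : State n) : Set where
  constructor at
  field
    length≡      : memory σ 0 ≡ n
    scalar≡      : ∀ c → memory σ (suc (toℕ c)) ≡ Vec.lookup s c
    denominator≡ : ∀ (i : Fin n) → m ≤ toℕ i → memory σ (7 + toℕ i) ≡ 8
    numerator≡   : ∀ (i : Fin n) → m ≤ toℕ i → memory σ (7 + (n + toℕ i)) ≡ f i
    output≡      : output σ ≡ out

open At

toℕ-cell≢ : ∀ (c : Cell) k → suc (toℕ c) ≢ 7 + k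
toℕ-cell≢ c k eq = ℕ.<⇒≱ (toℕ<n c)
  (ℕ.≤-trans (ℕ.m≤m+n 6 k) (ℕ.≤-reflexive (sym (ℕ.suc-injective eq))))

module _ {n m : ℕ} {s : Vec ℕ 6} {out : List ℕ} {f : Fin n → ℕ} {σ : State n} where

  write-cell : ∀ c a {h} → At m s f out σ →
    At m (s [ c ]≔ a) f out (state (memory σ [ suc (toℕ c) ↦ a ]) (output σ) h)
  write-cell c a A = at (length≡ A) scalar
    (λ i m≤i → trans (↦-other (memory σ) (toℕ-cell≢ c (toℕ i))) (denominator≡ A i m≤i))
    (λ i m≤i → trans (↦-other (memory σ) (toℕ-cell≢ c (n + toℕ i))) (numerator≡ A i m≤i))
    (output≡ A)
    where
    scalar : ∀ d → (memory σ [ suc (toℕ c) ↦ a ]) (suc (toℕ d)) ≡ Vec.lookup (s [ c ]≔ a) d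
    scalar d with c Fin.≟ d
    ... | yes refl = trans (↦-same (memory σ) {suc (toℕ c)} refl) (sym (Vec.lookup∘update c s a))
    ... | no c≢d   = trans (↦-other (memory σ) (c≢d ∘ toℕ-injective ∘ ℕ.suc-injective))
      (trans (scalar≡ A d) (sym (Vec.lookup∘update′ (c≢d ∘ sym) s a)))

  numerator-address : ∀ c → At m s f out σ →
    ⟦ numerator c ⟧ (memory σ) ≡ 7 + (n + Vec.lookup s c)
  numerator-address c A = cong (λ k → 7 + k) (cong₂ _+_ (length≡ A) (scalar≡ A c))

  write-numerator : ∀ c a → At m s f out σ →
    At m s (f [ Vec.lookup s c ↦ a ]ᶠ) out
       (state (memory σ [ ⟦ numerator c ⟧ (memory σ) ↦ a ]) (output σ) (history σ))
  write-numerator c a A rewrite numerator-address c A = at (length≡ A)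
    (λ d → trans (↦-other (memory σ) (toℕ-cell≢ d _ ∘ sym)) (scalar≡ A d))
    (λ i m≤i → trans (↦-other (memory σ)
                        (ℕ.>⇒≢ (ℕ.+-monoʳ-< 7 (ℕ.<-≤-trans (toℕ<n i) (ℕ.m≤m+n n _)))))
                      (denominator≡ A i m≤i))
    num (output≡ A)
    where
    v = Vec.lookup s c
    num : ∀ i → m ≤ toℕ i →
      (memory σ [ 7 + (n + v) ↦ a ]) (7 + (n + toℕ i)) ≡ (f [ v ↦ a ]ᶠ) i
    num i m≤i rewrite ≡ᵇ-cancelˡ n v (toℕ i) | numerator≡ A i m≤i = refl

  distance-value : ∀ c d → At m s f out σ → let a = Vec.lookup s c; b = Vec.lookup s d in
    ⟦ distance c d ⟧ (memory σ) ≡ (a ∸ b) + (b ∸ a)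
  distance-value c d A rewrite scalar≡ A c | scalar≡ A d = refl

  At-cong : ∀ {g} → (∀ i → f i ≡ g i) → At m s f out σ → At m s g out σ
  At-cong f≗g A = at (length≡ A) (scalar≡ A) (denominator≡ A)
    (λ i m≤i → trans (numerator≡ A i m≤i) (f≗g i)) (output≡ A)

distance≡0⇒≡ : ∀ a b → (a ∸ b) + (b ∸ a) ≡ 0 → a ≡ b
distance≡0⇒≡ a b eq = ℕ.≤-antisym (ℕ.m∸n≡0⇒m≤n (ℕ.m+n≡0⇒m≡0 (a ∸ b) eq))
                                  (ℕ.m∸n≡0⇒m≤n (ℕ.m+n≡0⇒n≡0 (a ∸ b) eq))

≡⇒distance≡0 : ∀ {a b} → a ≡ b → (a ∸ b) + (b ∸ a) ≡ 0
≡⇒distance≡0 {a} refl = cong₂ _+_ (ℕ.n∸n≡0 a) (ℕ.n∸n≡0 a)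

-- A Hoare logic with built-in time bounds.

module Logic {n} {Φ : Formula n} (O : Oracle Φ) where

  -- The time bound depends on the program text and n alone, so assertions never mention time.
  Exec : Program → (State n → Set) → State n → Set
  Exec P B σ = ∃[ τ ] ∃[ t ] (O ⊢ P , σ ⇓ τ [ t ]) × t ≤ cost (suc n) P × B τ

  record Triple (A : State n → Set) (P : Program) (B : State n → Set) : Set where
    field exec : ∀ {σ} → A σ → Exec P B σ

  open Triple public

  infixr 4 _⊢⨾_

  _⊢⨾_ : ∀ {A B C P Q} → Triple A P B → Triple B Q C → Triple A (P ⨾ Q) C
  exec (p ⊢⨾ q) a with exec p a
  ... | _ , _ , run , s≤ , b with exec q b
  ...   | _ , _ , run′ , t≤ , c = _ , _ , seq run run′ , ℕ.+-mono-≤ s≤ t≤ , c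

  weaken : ∀ {A A′ B B′ P} → (∀ {σ} → A′ σ → A σ) → (∀ {σ} → B σ → B′ σ) →
           Triple A P B → Triple A′ P B′
  exec (weaken A′⊆A B⊆B′ p) a with exec p (A′⊆A a)
  ... | _ , _ , run , t≤ , b = _ , _ , run , t≤ , B⊆B′ b

  ⊢∃ : ∀ {X : Set} {A : X → State n → Set} {B P} →
       (∀ x → Triple (A x) P B) → Triple (λ σ → ∃[ x ] A x σ) P B
  exec (⊢∃ p) (x , a) = exec (p x) a

  ⊢pure : ∀ {X : Set} {A : State n → Set} {B P} →
       (X → Triple A P B) → Triple (λ σ → X × A σ) P B
  exec (⊢pure p) (x , a) = exec (p x) a

  ⊢skip : ∀ {A} → Triple A skip A
  exec ⊢skip a = _ , _ , skip , ℕ.≤-refl , a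

  ⊢if : ∀ {A B e P Q} v → (∀ {σ} → A σ → ⟦ e ⟧ (memory σ) ≡ v) →
    (v ≢ 0 → Triple A P B) → (v ≡ 0 → Triple A Q B) → Triple A (ifnz e P Q) B
  exec (⊢if {P = P} {Q} v e≡v p q) a with v ℕ.≟ 0
  ... | yes v≡0 with exec (q v≡0) a
  ...   | _ , _ , run , t≤ , b =
    _ , _ , if-zero (trans (e≡v a) v≡0) run , s≤s (ℕ.≤-trans t≤ (ℕ.m≤n+m _ _)) , b
  exec (⊢if {P = P} {Q} v e≡v p q) a | no v≢0 with exec (p v≢0) a
  ...   | _ , _ , run , t≤ , b =
    _ , _ , if-nonzero (v≢0 ∘ trans (sym (e≡v a))) run , s≤s (ℕ.≤-trans t≤ (ℕ.m≤m+n _ _)) , b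

  ⊢cell : ∀ c {m s f out e} a → (∀ {σ} → At m s f out σ → ⟦ e ⟧ (memory σ) ≡ a) →
          Triple (At m s f out) (address c ≔ e) (At m (s [ c ]≔ a) f out)
  exec (⊢cell c {m} {s} {f} {out} {e} a e≡a) {σ} A = _ , _ , assign , ℕ.≤-refl ,
    subst (λ v → At m (s [ c ]≔ v) f out
                    (state (memory σ [ suc (toℕ c) ↦ ⟦ e ⟧ (memory σ) ]) (output σ) (history σ)))
          (e≡a A) (write-cell c _ A)

  ⊢numerator : ∀ c {m s f out} a →
    Triple (At m s f out) (numerator c ≔ const a) (At m s (f [ Vec.lookup s c ↦ a ]ᶠ) out)
  exec (⊢numerator c a) A = _ , _ , assign , ℕ.≤-refl , write-numerator c a A

  ⊢emit : ∀ {m s f out e} a → (∀ {σ} → At m s f out σ → ⟦ e ⟧ (memory σ) ≡ a) →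
          Triple (At m s f out) (emit e) (At m s f (out ∷ʳ a))
  exec (⊢emit a e≡a) A = _ , _ , emit , ℕ.≤-refl ,
    at (length≡ A) (scalar≡ A) (denominator≡ A) (numerator≡ A)
       (cong₂ _∷ʳ_ (output≡ A) (e≡a A))

  ⊢query : ∀ {s f out} (f≤8 : ∀ i → f i ≤ 8) →
    Triple (At 0 s f out) (query (address R) (const 7 ⊕ inputSize) (const 7))
           (λ σ → ∃[ ρ ] Admissible Φ (queryOf f f≤8) ρ × At 0 (s [ R ]≔ code ρ) f out σ)
  exec (⊢query {f = f} f≤8) {σ} A =
    _ , _ , query (queryOf f f≤8) holds , ℕ.≤-refl , _ , admissible O _ _ , write-cell R _ A
    where
    M = memory σ
    -- With the memory cells generalised to variables, matching on `refl` makes the denominator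
    -- literally 8, for which the `NonZero` witness is found.
    fraction : ∀ {a b d k} → d ≡ 8 → a ≡ b → k ≡ (+ b / 8) →
               ∃[ nz ] k ≡ _/_ (+ a) d {{nz}}
    fraction refl refl eq = _ , eq
    holds : Holds M (7 + M 0) 7 (queryOf f f≤8)
    holds i rewrite length≡ A =
      fraction (denominator≡ A i z≤n) (numerator≡ A i z≤n) (value-queryOf f f≤8 i)

  -- The invariant is indexed by the counter, so there are exactly `b` passes, and `b ≤ suc n` makes
  -- the syntactic cost of the loop a valid bound.
  ⊢for : ∀ {A c e P} b (I : ℕ → State n → Set) →
    (∀ {m σ} → I m σ → memory σ (suc (toℕ c)) ≡ m) → b ≤ suc n →
    Triple A (address c ≔ e) (I b) →
    (∀ m → m < b → Triple (I (suc m)) (address c ≔ cell c ⊖ const 1 ⨾ P) (I m)) →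
    Triple A (for c e P) (I 0)
  ⊢for {c = c} {P = P} b I counter b≤N start step = start ⊢⨾ loop
    where
    body = address c ≔ cell c ⊖ const 1 ⨾ P
    C = cost (suc n) body

    iterate : ∀ m → m ≤ b → ∀ {σ} → I m σ →
      ∃[ τ ] ∃[ t ] (O ⊢ while (cell c) body , σ ⇓ τ [ t ]) × t ≤ suc (m * suc C) × I 0 τ
    iterate zero    m≤b i = _ , _ , while-zero (counter i) , ℕ.≤-refl , i
    iterate (suc m) m<b i with exec (step m m<b) i
    ... | _ , s , run , s≤ , i′ with iterate m (ℕ.<⇒≤ m<b) i′
    ...   | _ , t , run′ , t≤ , i″ =
      _ , _ , while-nonzero (λ eq → ℕ.1+n≢0 (trans (sym (counter i)) eq)) run run′ ,
      s≤s (ℕ.≤-trans (ℕ.+-mono-≤ s≤ t≤) (ℕ.≤-reflexive (ℕ.+-suc C (m * suc C)))) , i″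

    loop : Triple (I b) (while (cell c) body) (I 0)
    exec loop i with iterate b ℕ.≤-refl i
    ... | _ , _ , run , t≤ , i′ =
      _ , _ , run , ℕ.≤-trans t≤ (s≤s (ℕ.*-monoˡ-≤ (suc C) b≤N)) , i′

  Scalars : (v₁ v₂ v₃ r j ok : ℕ) → List ℕ → State n → Set
  Scalars v₁ v₂ v₃ r j ok = At 0 (v₁ ∷ v₂ ∷ v₃ ∷ r ∷ j ∷ ok ∷ []) half

  module _ (Φ-2SAT : Is2SAT Φ) where

    ⊢probe : ∀ {k v₁ v₂ v₃ r j ok out} → k ≤ 8 → ∀ s₁ s₂ s₃ →
      Triple (Scalars v₁ v₂ v₃ r j ok out) (probe k s₁ s₂ s₃)
        (λ σ → ∃[ ρ ] Maximal Φ-2SAT (numerators (forced s₁ v₁ s₂ v₂) k s₃ v₃) ρ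
                      × Scalars v₁ v₂ v₃ (code ρ) j ok out σ)
    ⊢probe {k} {v₁} {v₂} {v₃} k≤8 s₁ s₂ s₃ =
      ⊢numerator V₃ _ ⊢⨾ ⊢numerator V₁ _ ⊢⨾
      weaken id (At-cong set) (⊢numerator V₂ _) ⊢⨾
      ⊢query (numerators≤8 h k≤8 s₃ v₃) ⊢⨾
      ⊢∃ λ ρ → ⊢pure λ admissible →
      weaken id (λ A → ρ , admissible⇒maximal Φ-2SAT _ (numerators≤8 h k≤8 s₃ v₃) admissible ,
                       At-cong reset A)
        (⊢numerator V₃ 4 ⊢⨾ ⊢numerator V₁ 4 ⊢⨾ ⊢numerator V₂ 4)
      where
      h : Fin n → Maybe Bool
      h = forced s₁ v₁ s₂ v₂
      set : ∀ i → (((half [ v₃ ↦ numeratorFor s₃ k ]ᶠ) [ v₁ ↦ numeratorFor s₁ 8 ]ᶠ)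
                    [ v₂ ↦ numeratorFor s₂ 8 ]ᶠ) i ≡ numerators h k s₃ v₃ i
      set i with v₂ ≡ᵇ toℕ i | v₁ ≡ᵇ toℕ i
      ... | true  | _     = refl
      ... | false | true  = refl
      ... | false | false = refl
      reset : ∀ i → (((numerators h k s₃ v₃ [ v₃ ↦ 4 ]ᶠ) [ v₁ ↦ 4 ]ᶠ) [ v₂ ↦ 4 ]ᶠ) i ≡ 4
      reset i with v₂ ≡ᵇ toℕ i | v₁ ≡ᵇ toℕ i | v₃ ≡ᵇ toℕ i
      ... | true  | _     | _     = refl
      ... | false | true  | _     = refl
      ... | false | false | true  = refl
      ... | false | false | false = refl

    Retained : (ok a ok′ : ℕ) → Set
    Retained ok a ok′ = (ok′ ≢ 0 → ok ≢ 0 × a ≢ 0) × (ok ≢ 0 → a ≢ 0 → ok′ ≢ 0)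

    ⊢guard : ∀ {e v₁ v₂ v₃ r j ok out} a →
      (∀ {σ} → Scalars v₁ v₂ v₃ r j ok out σ → ⟦ e ⟧ (memory σ) ≡ a) →
      Triple (Scalars v₁ v₂ v₃ r j ok out) (guard e)
        (λ σ → ∃[ ok′ ] Retained ok a ok′ × Scalars v₁ v₂ v₃ r j ok′ out σ)
    ⊢guard a e≡a = ⊢if a e≡a
      (λ a≢0 → weaken id (λ A → _ , ((λ ok≢0 → ok≢0 , a≢0) , (λ ok≢0 _ → ok≢0)) , A) ⊢skip)
      (λ a≡0 → weaken id (λ A → _ , (contradiction refl , (λ _ a≢0 → contradiction a≡0 a≢0)) , A)
                         (⊢cell OK 0 (λ _ → refl)))

-- Soundness and completeness of the test of one candidate.

module _ {n} {Φ : Formula n} (O : Oracle Φ) (Φ-2SAT : Is2SAT Φ) where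
  open Logic O

  -- For `satisfied` there is no clause to constrain; a passed test also gives `code ρ₀ ≢ 0`, which
  -- rules that case out.
  Excludes : (Fin n → Maybe Bool) → Response Φ → Literal n → Set
  Excludes h satisfied    ℓ = ⊤
  Excludes h (violated j) ℓ = ℓ ∈ lits Φ-2SAT j → Forced h ℓ

  module Test (s₁ s₂ : Bool) (v₁ v₂ : ℕ) where

    h : Fin n → Maybe Bool
    h = forced s₁ v₁ s₂ v₂

    -- The first implication is soundness: a raised flag vouches for every literal probed so far.
    -- The second is completeness: a minimal clause never lets the flag drop.
    Testing : Response Φ → (Bool → Fin n → Set) → (v₃ : ℕ) → List ℕ → State n → Set
    Testing ρ₀ Tested v₃ out σ = ∃[ r ] ∃[ ok ]
      ((ok ≢ 0 → code ρ₀ ≢ 0 × (∀ s i → Tested s i → Excludes h ρ₀ (lit s i))) ×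
       (∀ i → Minimal Φ-2SAT h i → ok ≢ 0)) ×
      Scalars v₁ v₂ v₃ r (code ρ₀) ok out σ

    ⊢check : ∀ {ρ₀ out Tested} s₀ v₀ → Maximal Φ-2SAT (numerators h 4 s₀ v₀) ρ₀ → ∀ s i →
      Triple (Testing ρ₀ Tested (toℕ i) out) (check s₁ s₂ s)
             (Testing ρ₀ (λ s′ i′ → Tested s′ i′ ⊎ s′ ≡ s × i′ ≡ i) (toℕ i) out)
    ⊢check {ρ₀} s₀ v₀ max₀ s i =
      ⊢∃ λ r → ⊢∃ λ ok → ⊢pure λ (tested , alive) →
      ⊢probe Φ-2SAT (ℕ.m≤m+n 1 7) s₁ s₂ s ⊢⨾
      ⊢∃ λ ρ₁ → ⊢pure λ max₁ →
      ⊢guard Φ-2SAT _ (λ A → cong (1 ∸_) (distance-value R J A)) ⊢⨾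
      ⊢∃ λ ok₁ → ⊢pure λ (only₁ , keep₁) →
      ⊢probe Φ-2SAT z≤n s₁ s₂ s ⊢⨾
      ⊢∃ λ ρ₂ → ⊢pure λ max₂ →
      weaken id
        (λ (ok₂ , (only₂ , keep₂) , A) → _ , ok₂ ,
          ( (λ ok₂≢0 →
              let ok₁≢0 , ρ₂≢0 = only₂ ok₂≢0
                  ok≢0 , same  = only₁ ok₁≢0
                  ρ₀≢0 , done  = tested ok≢0
              in ρ₀≢0 , λ { s′ i′ (inj₁ t) → done s′ i′ t
                          ; s′ i′ (inj₂ (refl , refl)) →
                              excludes ρ₀ ρ₁ max₀ max₁ max₂ (1∸≢0 same) ρ₂≢0 })
          , λ k minimal →
              keep₂ (keep₁ (alive k minimal)
                      (λ eq → 1∸distance (cong code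
                        (trans (minimal⇒violated Φ-2SAT h (inj₁ refl) s (toℕ i) minimal max₁)
                          (sym (minimal⇒violated Φ-2SAT h (inj₂ refl) s₀ v₀ minimal max₀)))) eq))
                    (minimal⇒unsatisfied Φ-2SAT h 0 s (toℕ i) minimal max₂))
          , A)
        (⊢guard Φ-2SAT _ (λ A → scalar≡ A R))
      where
      1∸≢0 : ∀ {a b} → 1 ∸ ((a ∸ b) + (b ∸ a)) ≢ 0 → a ≡ b
      1∸≢0 {a} {b} ≢0 with (a ∸ b) + (b ∸ a) in eq
      ... | zero  = distance≡0⇒≡ a b eq
      ... | suc d = contradiction (ℕ.0∸n≡0 d) ≢0
      1∸distance : ∀ {a b} → a ≡ b → 1 ∸ ((a ∸ b) + (b ∸ a)) ≢ 0
      1∸distance {a} {b} a≡b rewrite ≡⇒distance≡0 a≡b = λ ()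
      excludes : ∀ ρ₀ ρ₁ {ρ₂} → Maximal Φ-2SAT (numerators h 4 s₀ v₀) ρ₀ →
        Maximal Φ-2SAT (numerators h 1 s (toℕ i)) ρ₁ →
        Maximal Φ-2SAT (numerators h 0 s (toℕ i)) ρ₂ →
        code ρ₁ ≡ code ρ₀ → code ρ₂ ≢ 0 → Excludes h ρ₀ (lit s i)
      excludes satisfied    _  _ _ _ _ _ = tt
      excludes (violated j) ρ₁ max₀ max₁ max₂ same ρ₂≢0
        rewrite code-injective {ρ = ρ₁} {violated j} same =
        answers⇒forced Φ-2SAT h s₀ v₀ s i max₀ max₁ max₂ ρ₂≢0

    ⊢test : ∀ {v₃ r j ok out} → Triple (Scalars v₁ v₂ v₃ r j ok out) (test s₁ s₂)
      (λ σ → ∃[ ρ₀ ] Testing ρ₀ (λ _ _ → ⊤) 0 out σ)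
    ⊢test {v₃} {out = out} =
      ⊢probe Φ-2SAT (ℕ.m≤m+n 4 4) s₁ s₂ true ⊢⨾
      ⊢∃ λ ρ₀ → ⊢pure λ max₀ →
      ⊢cell J (code ρ₀) (λ A → scalar≡ A R) ⊢⨾
      ⊢cell OK (code ρ₀) (λ A → scalar≡ A R) ⊢⨾
      weaken id (λ (r , ok , (tested , alive) , A) → ρ₀ , r , ok ,
          ((λ ok≢0 → let ρ₀≢0 , done = tested ok≢0 in ρ₀≢0 , λ s i _ → done s i z≤n) , alive) , A)
        -- The bound is n and not n + 1: probed literals sit on genuine variables.
        (⊢for n (λ m → Testing ρ₀ (λ _ i → m ≤ toℕ i) m out)
          (λ (_ , _ , _ , A) → scalar≡ A V₃) (ℕ.n≤1+n n)
          (weaken id (λ A → _ , _ ,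
              ((λ ρ₀≢0 → ρ₀≢0 , λ _ i n≤i → contradiction n≤i (ℕ.<⇒≱ (toℕ<n i))) ,
               (λ _ minimal → minimal⇒unsatisfied Φ-2SAT h 4 true v₃ minimal max₀)) , A)
            (⊢cell V₃ n (λ A → length≡ A)))
          (λ m m<n → subst
            (λ m → Triple (Testing ρ₀ (λ _ i → suc m ≤ toℕ i) (suc m) out)
                          (address V₃ ≔ cell V₃ ⊖ const 1 ⨾
                           check s₁ s₂ true ⨾ check s₁ s₂ false)
                          (Testing ρ₀ (λ _ i → m ≤ toℕ i) m out))
            (toℕ-fromℕ< m<n) (step ρ₀ max₀ (fromℕ< m<n))))
      where
      step : ∀ ρ₀ → Maximal Φ-2SAT (numerators h 4 true v₃) ρ₀ → ∀ i →
        Triple (Testing ρ₀ (λ _ i′ → suc (toℕ i) ≤ toℕ i′) (suc (toℕ i)) out)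
               (address V₃ ≔ cell V₃ ⊖ const 1 ⨾ check s₁ s₂ true ⨾ check s₁ s₂ false)
               (Testing ρ₀ (λ _ i′ → toℕ i ≤ toℕ i′) (toℕ i) out)
      step ρ₀ max₀ i =
        ⊢∃ (λ r → ⊢∃ λ ok → ⊢pure λ facts →
          weaken id (λ A → r , ok , facts , A)
            (⊢cell V₃ (toℕ i) (λ A → cong (_∸ 1) (scalar≡ A V₃)))) ⊢⨾
        ⊢check true v₃ max₀ true i ⊢⨾
        weaken id (λ (r , ok , (tested , alive) , A) → r , ok ,
            ((λ ok≢0 → let ρ₀≢0 , done = tested ok≢0 in
                        ρ₀≢0 , λ s i′ i≤i′ → done s i′ (cases s i′ i≤i′)) , alive) , A)
          (⊢check true v₃ max₀ false i)
        where
        cases : ∀ s i′ → toℕ i ≤ toℕ i′ →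
          (toℕ i < toℕ i′ ⊎ s ≡ true × i′ ≡ i) ⊎ s ≡ false × i′ ≡ i
        cases s i′ i≤i′ with ℕ.m≤n⇒m<n∨m≡n i≤i′ | s
        ... | inj₁ i<i′ | _     = inj₁ (inj₁ i<i′)
        ... | inj₂ i≡i′ | true  = inj₁ (inj₂ (refl , toℕ-injective (sym i≡i′)))
        ... | inj₂ i≡i′ | false = inj₂ (refl , toℕ-injective (sym i≡i′))

-- Candidate clauses and their encoding.

++-encode : ∀ {n} (Ψ : Formula n) C → encode Ψ ++ encodeClause C ≡ encode (Ψ ∷ʳ C)
++-encode Ψ C = sym (trans (List.concatMap-++ encodeClause Ψ (C ∷ []))
                           (cong (encode Ψ ++_) (List.++-identityʳ (encodeClause C))))

module _ {n : ℕ} where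

  -- An index without a variable stands for an absent literal, so pairs of indices up to n describe
  -- clauses with zero, one or two literals.
  literalAt : Bool → ℕ → List (Literal n)
  literalAt s v with v ℕ.<? n
  ... | yes v<n = lit s (fromℕ< v<n) ∷ []
  ... | no _    = []

  var-lit : ∀ s (i : Fin n) → var (lit s i) ≡ i
  var-lit true  i = refl
  var-lit false i = refl

  sign-lit : ∀ s (i : Fin n) → sign (lit s i) ≡ s
  sign-lit true  i = refl
  sign-lit false i = refl

  lit-sign-var : ∀ (ℓ : Literal n) → lit (sign ℓ) (var ℓ) ≡ ℓ
  lit-sign-var (pos i) = refl
  lit-sign-var (neg i) = refl

  encode-lit : ∀ s (i : Fin n) → encodeLiteral (lit s i) ≡ (if s then 1 else 2) ∷ toℕ i ∷ []
  encode-lit true  i = refl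
  encode-lit false i = refl

  literalAt-var : ∀ ℓ → literalAt (sign ℓ) (toℕ (var ℓ)) ≡ ℓ ∷ []
  literalAt-var ℓ with toℕ (var ℓ) ℕ.<? n
  ... | yes v<n = cong (_∷ [])
    (trans (cong (lit (sign ℓ)) (Fin.fromℕ<-toℕ (var ℓ) v<n)) (lit-sign-var ℓ))
  ... | no v≮n  = contradiction (toℕ<n (var ℓ)) v≮n

  literalAt-n : ∀ s → literalAt s n ≡ []
  literalAt-n s with n ℕ.<? n
  ... | yes n<n = contradiction n<n (ℕ.<-irrefl refl)
  ... | no _    = refl

  ∈-literalAt⁻ : ∀ {s v ℓ} → ℓ ∈ literalAt s v → v ≡ toℕ (var ℓ) × s ≡ sign ℓ
  ∈-literalAt⁻ {s} {v} ℓ∈ with v ℕ.<? n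
  ∈-literalAt⁻ {s} (here refl) | yes v<n =
    trans (sym (toℕ-fromℕ< v<n)) (cong toℕ (sym (var-lit s _))) , sym (sign-lit s _)

  -- Dropping the first literal when the indices agree mirrors the precedence in `forced` and keeps
  -- the variables distinct.
  targetLiterals : (s₁ : Bool) (v₁ : ℕ) (s₂ : Bool) (v₂ : ℕ) → List (Literal n)
  targetLiterals s₁ v₁ s₂ v₂ =
    (if v₁ ≡ᵇ v₂ then [] else literalAt s₁ v₁) ++ literalAt s₂ v₂

  target : (s₁ : Bool) (v₁ : ℕ) (s₂ : Bool) (v₂ : ℕ) → Clause n
  target s₁ v₁ s₂ v₂ = clause (targetLiterals s₁ v₁ s₂ v₂) targetDistinct
    where
    targetDistinct : AllPairs (λ ℓ ℓ′ → var ℓ ≢ var ℓ′) (targetLiterals s₁ v₁ s₂ v₂)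
    targetDistinct with v₁ ≡ᵇ v₂ in eq | v₁ ℕ.<? n | v₂ ℕ.<? n
    ... | true  | _        | yes _    = [] ∷ []
    ... | true  | _        | no _     = []
    ... | false | yes _    | no _     = [] ∷ []
    ... | false | no _     | yes _    = [] ∷ []
    ... | false | no _     | no _     = []
    ... | false | yes v₁<n | yes v₂<n = (different ∷ []) ∷ [] ∷ []
      where
      different : var (lit s₁ (fromℕ< v₁<n)) ≢ var (lit s₂ (fromℕ< v₂<n))
      different same rewrite var-lit s₁ (fromℕ< v₁<n) | var-lit s₂ (fromℕ< v₂<n) =
        ≡ᵇ-false {v₁} eq (Fin.fromℕ<-injective v₁ v₂ v₁<n v₂<n same)

  forced⇒∈target : ∀ s₁ v₁ s₂ v₂ {ℓ} → Forced (forced s₁ v₁ s₂ v₂) ℓ →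
                   ℓ ∈ targetLiterals s₁ v₁ s₂ v₂
  forced⇒∈target s₁ v₁ s₂ v₂ {ℓ} eq with v₂ ≡ᵇ toℕ (var ℓ) in e₂
  ... | true rewrite just-injective eq | ≡ᵇ-true {v₂} e₂ | literalAt-var ℓ =
    ∈-++⁺ʳ _ (here refl)
  ... | false with v₁ ≡ᵇ toℕ (var ℓ) in e₁
  ...   | true rewrite just-injective eq | ≡ᵇ-true {v₁} e₁
                     | ≢⇒≡ᵇ-false {toℕ (var ℓ)} {v₂} (≡ᵇ-false {v₂} e₂ ∘ sym)
                     | literalAt-var ℓ = here refl

  ∈target⇒forced : ∀ s₁ v₁ s₂ v₂ {ℓ} → ℓ ∈ targetLiterals s₁ v₁ s₂ v₂ →
                   Forced (forced s₁ v₁ s₂ v₂) ℓ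
  ∈target⇒forced s₁ v₁ s₂ v₂ {ℓ} ℓ∈
    with ∈-++⁻ (if v₁ ≡ᵇ v₂ then [] else literalAt s₁ v₁) ℓ∈
  ∈target⇒forced s₁ v₁ s₂ v₂ {ℓ} ℓ∈ | inj₂ ℓ∈₂ with ∈-literalAt⁻ {s₂} {v₂} ℓ∈₂
  ... | refl , refl rewrite ≡ᵇ-refl (toℕ (var ℓ)) = refl
  ∈target⇒forced s₁ v₁ s₂ v₂ {ℓ} ℓ∈ | inj₁ ℓ∈₁ with v₁ ≡ᵇ v₂ in e
  ... | false with ∈-literalAt⁻ {s₁} {v₁} ℓ∈₁
  ...   | refl , refl rewrite ≢⇒≡ᵇ-false {v₂} {toℕ (var ℓ)} (≡ᵇ-false {toℕ (var ℓ)} e ∘ sym)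
                            | ≡ᵇ-refl (toℕ (var ℓ)) = refl

-- Output and the loops over all candidates.

module _ {n} {Φ : Formula n} (O : Oracle Φ) (Φ-2SAT : Is2SAT Φ) where
  open Logic O

  ⊢emitLiteral : ∀ s c {sc f out} → Triple (At 0 sc f out) (emitLiteral s c)
    (At 0 sc f (out ++ concatMap encodeLiteral (literalAt {n} s (Vec.lookup sc c))))
  ⊢emitLiteral s c {sc} {f} {out} =
    ⊢if (n ∸ v) (λ A → cong₂ _∸_ (length≡ A) (scalar≡ A c)) present absent
    where
    v = Vec.lookup sc c
    present : n ∸ v ≢ 0 → Triple (At 0 sc f out)
      (emit (const (if s then 1 else 2)) ⨾ emit (cell c))
      (At 0 sc f (out ++ concatMap encodeLiteral (literalAt {n} s v)))
    present ≢0 with v ℕ.<? n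
    ... | no v≮n  = contradiction (ℕ.m≤n⇒m∸n≡0 (ℕ.≮⇒≥ v≮n)) ≢0
    ... | yes v<n rewrite encode-lit s (fromℕ< v<n) | toℕ-fromℕ< v<n =
      subst (λ o → Triple _ _ (At 0 sc f o)) (List.++-assoc out _ _)
        (⊢emit _ (λ _ → refl) ⊢⨾ ⊢emit v (λ A → scalar≡ A c))
    absent : n ∸ v ≡ 0 → Triple (At 0 sc f out) skip
      (At 0 sc f (out ++ concatMap encodeLiteral (literalAt {n} s v)))
    absent ≡0 with v ℕ.<? n
    ... | yes v<n = contradiction ≡0 (ℕ.m>n⇒m∸n≢0 v<n)
    ... | no _ rewrite List.++-identityʳ out = ⊢skip

  ⊢emitClause : ∀ s₁ s₂ {v₁ v₂ v₃ r j ok out} →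
    Triple (Scalars v₁ v₂ v₃ r j ok out) (emitClause s₁ s₂)
           (Scalars v₁ v₂ v₃ r j ok (out ++ encodeClause (target s₁ v₁ s₂ v₂)))
  ⊢emitClause s₁ s₂ {v₁} {v₂} {v₃} {r} {j} {ok} {out} =
    ⊢if _ (distance-value V₁ V₂) different same ⊢⨾
    ⊢emitLiteral s₂ V₂ ⊢⨾
    weaken id (λ {σ} → subst (λ o → Scalars v₁ v₂ v₃ r j ok o σ) reassociate)
           (⊢emit 0 λ _ → refl)
    where
    L₁ L₂ : List (Literal n)
    L₁ = if v₁ ≡ᵇ v₂ then [] else literalAt s₁ v₁
    L₂ = literalAt s₂ v₂
    E = concatMap (encodeLiteral {n})
    different : (v₁ ∸ v₂) + (v₂ ∸ v₁) ≢ 0 →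
      Triple (Scalars v₁ v₂ v₃ r j ok out) (emitLiteral s₁ V₁)
             (Scalars v₁ v₂ v₃ r j ok (out ++ E L₁))
    different ≢0 rewrite ≢⇒≡ᵇ-false {v₁} {v₂} (≢0 ∘ ≡⇒distance≡0) = ⊢emitLiteral s₁ V₁
    same : (v₁ ∸ v₂) + (v₂ ∸ v₁) ≡ 0 →
      Triple (Scalars v₁ v₂ v₃ r j ok out) skip (Scalars v₁ v₂ v₃ r j ok (out ++ E L₁))
    same ≡0 with refl ← distance≡0⇒≡ v₁ v₂ ≡0
      rewrite ≡ᵇ-refl v₁ | List.++-identityʳ out = ⊢skip
    reassociate : ((out ++ E L₁) ++ E L₂) ∷ʳ 0 ≡ out ++ (E (L₁ ++ L₂) ∷ʳ 0)
    reassociate = begin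
      ((out ++ E L₁) ++ E L₂) ∷ʳ 0  ≡⟨ cong (_∷ʳ 0) (List.++-assoc out (E L₁) (E L₂)) ⟩
      (out ++ E L₁ ++ E L₂) ∷ʳ 0
        ≡⟨ cong (λ o → (out ++ o) ∷ʳ 0) (List.concatMap-++ encodeLiteral L₁ L₂) ⟨
      (out ++ E (L₁ ++ L₂)) ∷ʳ 0    ≡⟨ List.++-assoc out _ _ ⟩
      out ++ (E (L₁ ++ L₂) ∷ʳ 0)    ∎
      where open ≡-Reasoning

  -- `Minimal` only places clause `i` inside the target, so the conclusion is about the target; the
  -- two coincide once the target is chosen to be clause `i`.
  Covered : (s₁ : Bool) (v₁ : ℕ) (s₂ : Bool) (v₂ : ℕ) → Assignment n → Set
  Covered s₁ v₁ s₂ v₂ x =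
    ∀ i → Minimal Φ-2SAT (forced s₁ v₁ s₂ v₂) i → Satisfies x (target s₁ v₁ s₂ v₂)

  -- The emitted formula `Ψ` lies between `Φ` and `Q` in strength. `Q` collects what the attempts so
  -- far guarantee.
  Progress : ℕ → ℕ → (Assignment n → Set) → State n → Set
  Progress v₁ v₂ Q σ = ∃[ v₃ ] ∃[ r ] ∃[ j ] ∃[ ok ] ∃[ Ψ ]
    ((∀ x → Models x Φ → Models x Ψ) × (∀ x → Models x Ψ → Q x)) ×
    Scalars v₁ v₂ v₃ r j ok (encode Ψ) σ

  progress-map : ∀ {v₁ v₂ Q Q′} → (∀ {x} → Q x → Q′ x) →
                 ∀ {σ} → Progress v₁ v₂ Q σ → Progress v₁ v₂ Q′ σ
  progress-map Q⊆Q′ (_ , _ , _ , _ , _ , (sound , complete) , A) =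
    _ , _ , _ , _ , _ , (sound , λ x m → Q⊆Q′ (complete x m)) , A

  ⊢attempt : ∀ s₁ s₂ {v₁ v₂ Q} → Triple (Progress v₁ v₂ Q) (attempt s₁ s₂)
    (Progress v₁ v₂ (λ x → Q x × Covered s₁ v₁ s₂ v₂ x))
  ⊢attempt s₁ s₂ {v₁} {v₂} {Q} =
    ⊢∃ λ v₃ → ⊢∃ λ r → ⊢∃ λ j → ⊢∃ λ ok → ⊢∃ λ Ψ → ⊢pure λ (sound , complete) →
    Test.⊢test O Φ-2SAT s₁ s₂ v₁ v₂ ⊢⨾
    ⊢∃ λ ρ₀ → ⊢∃ λ r′ → ⊢∃ λ ok′ → ⊢pure λ (tested , alive) →
    ⊢if ok′ (λ A → scalar≡ A OK)
      (λ ok′≢0 → let ρ₀≢0 , excluded = tested ok′≢0 in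
        weaken id (λ {σ} A → 0 , r′ , code ρ₀ , ok′ , Ψ ∷ʳ C ,
            ( (λ x m → ++⁺ (sound x m) (implied ρ₀ ρ₀≢0 (λ s i → excluded s i tt) x m ∷ []))
            , (λ x m → complete x (++⁻ˡ Ψ m) , λ _ _ → All.head (++⁻ʳ Ψ m)))
            , subst (λ o → Scalars v₁ v₂ 0 r′ (code ρ₀) ok′ o σ) (++-encode Ψ C) A)
          (⊢emitClause s₁ s₂))
      (λ ok′≡0 → weaken id (λ A → 0 , r′ , code ρ₀ , ok′ , Ψ ,
            (sound , λ x m → complete x m ,
              λ i minimal → contradiction ok′≡0 (alive i minimal)) , A)
          ⊢skip)
    where
    C = target s₁ v₁ s₂ v₂
    h : Fin n → Maybe Bool
    h = forced s₁ v₁ s₂ v₂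
    -- All literals of clause `j` lie in the target, so a literal that makes clause `j` true makes
    -- the target true.
    implied : ∀ ρ → code ρ ≢ 0 → (∀ s i → Excludes O Φ-2SAT h ρ (lit s i)) →
              ∀ x → Models x Φ → Satisfies x C
    implied satisfied    ρ≢0 _ = contradiction refl ρ≢0
    implied (violated j) _ excluded x m
      with find (All.lookup m (∈-lookup j))
    ... | ℓ , ℓ∈ , ℓ-true = lose (forced⇒∈target s₁ v₁ s₂ v₂ ℓ-forced) ℓ-true
      where
      ℓ-forced : Forced h ℓ
      ℓ-forced = subst (λ ℓ → ℓ ∈ lits Φ-2SAT j → Forced h ℓ) (lit-sign-var ℓ)
                       (excluded (sign ℓ) (var ℓ)) ℓ∈

  ⊢attempts : ∀ {v₁ v₂ Q} → Triple (Progress v₁ v₂ Q) attempts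
    (Progress v₁ v₂ (λ x → Q x × (∀ s₁ s₂ → Covered s₁ v₁ s₂ v₂ x)))
  ⊢attempts =
    ⊢attempt true true ⊢⨾ ⊢attempt true false ⊢⨾ ⊢attempt false true ⊢⨾
    weaken id (progress-map λ ((((q , tt′) , tf) , ft) , ff) → q ,
        λ { true true → tt′ ; true false → tf ; false true → ft ; false false → ff })
      (⊢attempt false false)

  ⊢setV₁ : ∀ {v₁ v₂ Q e} a →
    (∀ {v₃ r j ok out σ} → Scalars v₁ v₂ v₃ r j ok out σ → ⟦ e ⟧ (memory σ) ≡ a) →
    Triple (Progress v₁ v₂ Q) (address V₁ ≔ e) (Progress a v₂ Q)
  ⊢setV₁ a e≡a = ⊢∃ λ _ → ⊢∃ λ _ → ⊢∃ λ _ → ⊢∃ λ _ → ⊢∃ λ _ → ⊢pure λ facts →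
    weaken id (λ A → _ , _ , _ , _ , _ , facts , A) (⊢cell V₁ a e≡a)

  ⊢setV₂ : ∀ {v₁ v₂ Q e} a →
    (∀ {v₃ r j ok out σ} → Scalars v₁ v₂ v₃ r j ok out σ → ⟦ e ⟧ (memory σ) ≡ a) →
    Triple (Progress v₁ v₂ Q) (address V₂ ≔ e) (Progress v₁ a Q)
  ⊢setV₂ a e≡a = ⊢∃ λ _ → ⊢∃ λ _ → ⊢∃ λ _ → ⊢∃ λ _ → ⊢∃ λ _ → ⊢pure λ facts →
    weaken id (λ A → _ , _ , _ , _ , _ , facts , A) (⊢cell V₂ a e≡a)

  inputSize+1 : ∀ {m s f out σ} → At m s f out σ → ⟦ inputSize ⊕ const 1 ⟧ (memory σ) ≡ suc n
  inputSize+1 A = trans (cong (_+ 1) (length≡ A)) (ℕ.+-comm n 1)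

  -- Loops count down, so the indices already handled form an upper segment, empty at n + 1.
  From : ℕ → (ℕ → Set) → Set
  From m P = ∀ v → m ≤ v → v ≤ n → P v

  from-vacuous : ∀ {P} → From (suc n) P
  from-vacuous v n<v v≤n = contradiction v≤n (ℕ.<⇒≱ n<v)

  from-step : ∀ {m P} → From (suc m) P → P m → From m P
  from-step {m} later now v m≤v v≤n with ℕ.m≤n⇒m<n∨m≡n m≤v
  ... | inj₁ m<v  = later v m<v v≤n
  ... | inj₂ refl = now

  ⊢inner : ∀ {v₁ Q} → Triple (λ σ → ∃[ v₂ ] Progress v₁ v₂ Q σ)
    (for V₂ (inputSize ⊕ const 1) attempts)
    (Progress v₁ 0 (λ x → Q x × From 0 (λ v₂ → ∀ s₁ s₂ → Covered s₁ v₁ s₂ v₂ x)))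
  ⊢inner {v₁} {Q} = ⊢for (suc n)
    (λ m → Progress v₁ m (λ x → Q x × From m (λ v₂ → ∀ s₁ s₂ → Covered s₁ v₁ s₂ v₂ x)))
    (λ (_ , _ , _ , _ , _ , _ , A) → scalar≡ A V₂) ℕ.≤-refl
    (⊢∃ λ _ → weaken id (progress-map λ q → q , from-vacuous) (⊢setV₂ (suc n) inputSize+1))
    (λ m _ → ⊢setV₂ m (λ A → cong (_∸ 1) (scalar≡ A V₂)) ⊢⨾
      weaken id (progress-map λ ((q , later) , now) → q , from-step later now) ⊢attempts)

  ⊢outer : ∀ {v₁ v₂ Q} → Triple (Progress v₁ v₂ Q)
    (for V₁ (inputSize ⊕ const 1)
      (for V₂ (inputSize ⊕ const 1) attempts))
    (λ σ → ∃[ v₂ ] Progress 0 v₂ (λ x →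
      Q x × From 0 (λ v₁ → From 0 (λ v₂ → ∀ s₁ s₂ → Covered s₁ v₁ s₂ v₂ x))) σ)
  ⊢outer {Q = Q} = ⊢for (suc n)
    (λ m σ → ∃[ v₂ ] Progress m v₂ (λ x →
      Q x × From m (λ v₁ → From 0 (λ v₂ → ∀ s₁ s₂ → Covered s₁ v₁ s₂ v₂ x))) σ)
    (λ (_ , _ , _ , _ , _ , _ , _ , A) → scalar≡ A V₁) ℕ.≤-refl
    (weaken id (λ p → _ , progress-map (λ q → q , from-vacuous) p) (⊢setV₁ (suc n) inputSize+1))
    (λ m _ → ⊢∃ (λ v₂ → weaken id (λ p → v₂ , p) (⊢setV₁ m (λ A → cong (_∸ 1) (scalar≡ A V₁)))) ⊢⨾
      weaken id (λ p → 0 , progress-map (λ ((q , later) , now) → q , from-step later now) p) ⊢inner)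

  ⊢initialise : Triple (_≡ initial n) initialise (Scalars 0 0 0 0 0 0 [])
  ⊢initialise = ⊢for (suc n)
    (λ m → At m (m ∷ 0 ∷ 0 ∷ 0 ∷ 0 ∷ 0 ∷ []) half [])
    (λ A → scalar≡ A V₁) ℕ.≤-refl
    (weaken start id (⊢cell V₁ (suc n) inputSize+1))
    (λ m _ → ⊢cell V₁ m (λ A → cong (_∸ 1) (scalar≡ A V₁)) ⊢⨾ fill m)
    where
    start : ∀ {σ} → σ ≡ initial n → At (suc n) (0 ∷ 0 ∷ 0 ∷ 0 ∷ 0 ∷ 0 ∷ []) half [] σ
    start refl = at refl
      (λ { zero → refl ; (suc zero) → refl ; (suc (suc zero)) → refl
         ; (suc (suc (suc zero))) → refl ; (suc (suc (suc (suc zero)))) → refl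
         ; (suc (suc (suc (suc (suc zero))))) → refl })
      (λ i n<i → contradiction n<i (ℕ.<-asym (toℕ<n i)))
      (λ i n<i → contradiction n<i (ℕ.<-asym (toℕ<n i))) refl

    fill : ∀ m {s out} → Triple (At (suc m) (m ∷ s) half out)
      (const 7 ⊕ cell V₁ ≔ const 8 ⨾ numerator V₁ ≔ const 4) (At m (m ∷ s) half out)
    exec (fill m {s} {out}) {σ} A = _ , _ , seq assign assign , ℕ.≤-refl , filled
      where
      M = memory σ
      filled : At m (m ∷ s) half out (state ((M [ 7 + M 1 ↦ 8 ]) [ 7 + (M 0 + M 1) ↦ 4 ])
                                            (output σ) (history σ))
      filled rewrite length≡ A | scalar≡ A V₁ = at (length≡ A)
        (λ d → trans (↦-other M₈ (toℕ-cell≢ d _ ∘ sym))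
              (trans (↦-other M (toℕ-cell≢ d _ ∘ sym)) (scalar≡ A d)))
        den num (output≡ A)
        where
        M₈ = M [ 7 + m ↦ 8 ]
        den : ∀ (i : Fin n) → m ≤ toℕ i → (M₈ [ 7 + (n + m) ↦ 4 ]) (7 + toℕ i) ≡ 8
        den i m≤i = trans
          (↦-other M₈ (ℕ.>⇒≢ (ℕ.+-monoʳ-< 7 (ℕ.<-≤-trans (toℕ<n i) (ℕ.m≤m+n n m)))))
          (den₈ (ℕ.m≤n⇒m<n∨m≡n m≤i))
          where
          den₈ : m < toℕ i ⊎ m ≡ toℕ i → M₈ (7 + toℕ i) ≡ 8
          den₈ (inj₁ m<i) = trans (↦-other M (ℕ.<⇒≢ (ℕ.+-monoʳ-< 7 m<i))) (denominator≡ A i m<i)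
          den₈ (inj₂ m≡i) = ↦-same M {7 + m} (cong (λ v → 7 + v) m≡i)
        num : ∀ (i : Fin n) → m ≤ toℕ i → (M₈ [ 7 + (n + m) ↦ 4 ]) (7 + (n + toℕ i)) ≡ 4
        num i m≤i with ℕ.m≤n⇒m<n∨m≡n m≤i
        ... | inj₂ m≡i = ↦-same M₈ {7 + (n + m)} (cong (λ v → 7 + (n + v)) m≡i)
        ... | inj₁ m<i = trans
          (↦-other M₈ (ℕ.<⇒≢ (ℕ.+-monoʳ-< 7 (ℕ.+-monoʳ-< n m<i))))
          (trans (↦-other M (ℕ.<⇒≢ (ℕ.+-monoʳ-< 7 (ℕ.<-≤-trans m<i (ℕ.m≤n+m (toℕ i) n)))))
                 (numerator≡ A i m<i))

  ⊢learn : Triple (_≡ initial n) learn (λ σ → ∃[ v₂ ] Progress 0 v₂ (λ x →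
    ∀ v₁ → v₁ ≤ n → ∀ v₂ → v₂ ≤ n → ∀ s₁ s₂ → Covered s₁ v₁ s₂ v₂ x) σ)
  ⊢learn =
    weaken id (λ A → 0 , 0 , 0 , 0 , [] , ((λ _ _ → []) , (λ _ _ → tt)) , A) ⊢initialise ⊢⨾
    weaken id (λ (_ , p) → _ , progress-map (λ (_ , all) v₁ v₁≤n v₂ v₂≤n →
                                  all v₁ z≤n v₁≤n v₂ z≤n v₂≤n) p)
      (⊢outer {Q = λ _ → ⊤})

-- Every clause follows from the covered candidates.

module _ {n : ℕ} where

  -- By counting, the distinct literals of `xs` already exhaust `ys`. This upgrades an inclusion of
  -- clauses to equality of literal sets.
  ⊆⇒⊇ : ∀ {xs ys : List (Literal n)} → AllPairs (λ ℓ ℓ′ → var ℓ ≢ var ℓ′) xs →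
        length xs ≤ 2 → length ys ≤ length xs →
        (∀ {ℓ} → ℓ ∈ xs → ℓ ∈ ys) → ∀ {ℓ} → ℓ ∈ ys → ℓ ∈ xs
  ⊆⇒⊇ {x ∷ []} {y ∷ []} _ _ _ xs⊆ys (here refl) with xs⊆ys (here refl)
  ... | here refl = here refl
  ⊆⇒⊇ {x ∷ x′ ∷ []} {y ∷ []} _ _ _ xs⊆ys (here refl) with xs⊆ys (here refl)
  ... | here refl = here refl
  ⊆⇒⊇ {x ∷ x′ ∷ []} {y ∷ y′ ∷ []} ((x≢x′ ∷ []) ∷ _) _ _ xs⊆ys ℓ∈
    with xs⊆ys (here refl) | xs⊆ys (there (here refl)) | ℓ∈
  ... | here refl         | here refl         | _                 = contradiction refl x≢x′
  ... | there (here refl) | there (here refl) | _                 = contradiction refl x≢x′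
  ... | here refl         | there (here refl) | here refl         = here refl
  ... | here refl         | there (here refl) | there (here refl) = there (here refl)
  ... | there (here refl) | here refl         | here refl         = there (here refl)
  ... | there (here refl) | here refl         | there (here refl) = here refl
  ⊆⇒⊇ {_ ∷ _ ∷ _ ∷ _} _ (s≤s (s≤s ()))
  ⊆⇒⊇ {_ ∷ []} {_ ∷ _ ∷ _} _ _ (s≤s ())
  ⊆⇒⊇ {_ ∷ _ ∷ []} {_ ∷ _ ∷ _ ∷ _} _ _ (s≤s (s≤s ()))

  -- Missing literals are filled with the dummy index n, whose sign is arbitrary.
  targetIndex : ∀ (L : List (Literal n)) → AllPairs (λ ℓ ℓ′ → var ℓ ≢ var ℓ′) L → length L ≤ 2 →
    ∃[ s₁ ] ∃[ v₁ ] ∃[ s₂ ] ∃[ v₂ ] (v₁ ≤ n × v₂ ≤ n × targetLiterals {n} s₁ v₁ s₂ v₂ ≡ L)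
  targetIndex [] _ _ = true , n , true , n , ℕ.≤-refl , ℕ.≤-refl , eq
    where
    eq : targetLiterals {n} true n true n ≡ []
    eq rewrite ≡ᵇ-refl n = literalAt-n {n} true
  targetIndex (ℓ ∷ []) _ _ =
    true , n , sign ℓ , toℕ (var ℓ) , ℕ.≤-refl , ℕ.<⇒≤ (toℕ<n (var ℓ)) , eq
    where
    eq : targetLiterals {n} true n (sign ℓ) (toℕ (var ℓ)) ≡ ℓ ∷ []
    eq rewrite ≢⇒≡ᵇ-false (ℕ.>⇒≢ (toℕ<n (var ℓ))) =
      cong₂ _++_ (literalAt-n {n} true) (literalAt-var ℓ)
  targetIndex (ℓ ∷ ℓ′ ∷ []) ((ℓ≢ℓ′ ∷ []) ∷ _) _ =
    sign ℓ , toℕ (var ℓ) , sign ℓ′ , toℕ (var ℓ′) ,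
    ℕ.<⇒≤ (toℕ<n (var ℓ)) , ℕ.<⇒≤ (toℕ<n (var ℓ′)) , eq
    where
    eq : targetLiterals (sign ℓ) (toℕ (var ℓ)) (sign ℓ′) (toℕ (var ℓ′)) ≡ ℓ ∷ ℓ′ ∷ []
    eq rewrite ≢⇒≡ᵇ-false {toℕ (var ℓ)} {toℕ (var ℓ′)} (ℓ≢ℓ′ ∘ toℕ-injective) =
      cong₂ _++_ (literalAt-var ℓ) (literalAt-var ℓ′)
  targetIndex (_ ∷ _ ∷ _ ∷ _) _ (s≤s (s≤s ()))

module _ {n} {Φ : Formula n} (O : Oracle Φ) (Φ-2SAT : Is2SAT Φ) (unique : RepetitionFree Φ) where
  open Logic O

  private
    L : Fin (length Φ) → List (Literal n)
    L = lits Φ-2SAT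

  -- Clauses strictly inside clause i are shorter, hence satisfied by induction;
  -- so if x falsified clause i, then clause i would be minimal and covered.
  covered⇒Models : ∀ {x} →
    (∀ v₁ → v₁ ≤ n → ∀ v₂ → v₂ ≤ n → ∀ s₁ s₂ → Covered O Φ-2SAT s₁ v₁ s₂ v₂ x) → Models x Φ
  covered⇒Models {x} covered = All.tabulate λ {C} C∈Φ →
    subst (Satisfies x) (sym (lookup-index C∈Φ))
          (go _ (Any.index C∈Φ) ℕ.≤-refl)
    where
    go : ∀ m i → length (L i) < m → Satisfies x (lookup Φ i)
    go (suc m) i (s≤s len≤m) with Any.any? (λ ℓ → evalLiteral x ℓ Bool.≟ true) (L i)
    ... | yes p         = p
    ... | no falsified with targetIndex (L i) (distinct (lookup Φ i)) (lits≤2 Φ-2SAT i)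
    ...   | s₁ , v₁ , s₂ , v₂ , v₁≤n , v₂≤n , target≡ =
      subst (Any _) target≡ (covered v₁ v₁≤n v₂ v₂≤n s₁ s₂ i
        ( All.tabulate (λ ℓ∈ → ∈target⇒forced s₁ v₁ s₂ v₂ (subst (_ ∈_) (sym target≡) ℓ∈))
        , λ k forced → only k (λ ℓ∈ → subst (_ ∈_) target≡
                                (forced⇒∈target s₁ v₁ s₂ v₂ (All.lookup forced ℓ∈)))))
      where
      shorter : ∀ k → k ≢ i → (∀ {ℓ} → ℓ ∈ L k → ℓ ∈ L i) → length (L k) < length (L i)
      -- A clause inside clause `i` that is no shorter would have the same literal set, against
      -- freedom from repetitions.
      shorter k k≢i k⊆i = ℕ.≰⇒> λ i≤k → unique k i k≢i
        (mk⇔ k⊆i (⊆⇒⊇ (distinct (lookup Φ k)) (lits≤2 Φ-2SAT k) i≤k k⊆i))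
      only : ∀ k → (∀ {ℓ} → ℓ ∈ L k → ℓ ∈ L i) → k ≡ i
      only k k⊆i with k Fin.≟ i
      ... | yes k≡i = k≡i
      ... | no k≢i with find (go m k (ℕ.<-≤-trans (shorter k k≢i k⊆i) len≤m))
      ...   | _ , ℓ∈ , ℓ-true = contradiction (lose (k⊆i ℓ∈) ℓ-true) falsified

theorem3 : ∃[ P ] ∃[ c ] ∃[ k ]
    ((n : ℕ) (Φ : Formula n) → Is2SAT Φ → RepetitionFree Φ → (O : Oracle Φ) →
    ∃[ τ ] ∃[ t ] (O ⊢ P , initial n ⇓ τ [ t ])
    × t ≤ c * suc n ^ k
    × (∃[ Φ′ ] output τ ≡ encode Φ′ × SAT Φ′ ≐ SAT Φ))
-- The exponent is 3: two loops choose the candidate and one the probed variable.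
theorem3 = learn , size learn , depth learn , λ n Φ Φ-2SAT unique O →
  let τ , t , run , t≤ , (_ , _ , _ , _ , _ , Ψ , (sound , complete) , A) =
        Logic.Triple.exec (⊢learn O Φ-2SAT) refl
  in τ , t , run , ℕ.≤-trans t≤ (cost≤ n learn) , Ψ , output≡ A ,
     (λ {x} Ψ-sat → Models⇒SAT x Φ
        (covered⇒Models O Φ-2SAT unique (complete x (SAT⇒Models x Ψ Ψ-sat)))) ,
     (λ {x} Φ-sat → Models⇒SAT x Ψ (sound x (SAT⇒Models x Φ Φ-sat)))
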